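{- Let $\alpha\geq 2$ be any ordinal. The variety $\mathsf{Drs}_{\alpha}$ of representable relativized diagonal free algebras of dimension $\alpha$ enjoys each of the following: (1) Finite schema axiomatizability (finite axiomatizability if $\alpha$ is finite). (2) Finite base property, i.e. it is generated (as a variety) by its algebras whose base is finite. (3) Decidable equational theory. (4) It is generated (as a variety) by its locally finite dimensional algebras, for the case when $\alpha$ is infinite. (5) Super amalgamation property.
   Context: Sequences and cylindrifications. For sequences $f,g$ of length $\alpha$ and $i\in\alpha$, write $f\equiv_i g$ iff $g=f_i^u$ for some $u$, where $f_i^u$ is the sequence which is like $f$ except that its value at $i$ equals $u$. For a set $V$ of sequences of length $\alpha$, $i\in\alpha$ and $Y\subseteq V$, put $C_i^{[V]}Y=\{f\in V:(\exists g\in Y)\ f\equiv_i g\}$. Let $\mathfrak{P}(V)=\langle \mathcal{P}(V),\cap,\cup,\setminus,\emptyset,V,C_i^{[V]}\rangle_{i\in\alpha}$, where $\mathcal{P}(V)$ is the family of all subsets of $V$ and $\setminus$ is complementation relative to $V$; it is an algebra in the signature $\cdot,+,-,0,1,c_i$ $(i\in\alpha)$. The class. $\mathsf{Drs}_\alpha$ is the class of all isomorphic copies of subalgebras of algebras $\mathfrak{P}(V)$ with $\emptyset\neq V\subseteq{}^{\alpha}U$ for some set $U$. For a subalgebra $\mathfrak{A}$ of $\mathfrak{P}(V)$, $V$ is called the unit of $\mathfrak{A}$ and the smallest set $U$ with $V\subseteq{}^{\alpha}U$ is called the base of $\mathfrak{A}$. Finite (schema) axiomatizability. An equation schema is an equation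 built from variables, $\cdot,+,-,0,1$ and symbols $c_{\iota}$, where the $\iota$ are index metavariables; its instances are obtained by replacing the distinct index metavariables by distinct elements of $\alpha$. A class is finite schema axiomatizable if it is the class of all models of all instances of some finite set of equation schemas; it is finitely axiomatizable if it is the class of all models of some finite set of equations. Decidable equational theory. The set of all equations in the signature $\cdot,+,-,0,1,c_i$ $(i\in\alpha)$ that are valid in $\mathsf{Drs}_\alpha$ is decidable. Locally finite dimensional. For an element $a$ of an algebra, $\Delta a=\{i\in\alpha: c_i a\neq a\}$; the algebra is locally finite dimensional if $\Delta a$ is finite for each of its elements $a$. Super amalgamation property. For all $\mathfrak{A}_0,\mathfrak{A}_1,\mathfrak{A}_2$ in the class and all embeddings $e_1:\mathfrak{A}_0\to\mathfrak{A}_1$, $e_2:\mathfrak{A}_0\to\mathfrak{A}_2$ there are an algebra $\mathfrak{A}$ in the class and embeddings $m_1:\mathfrak{A}_1\to\mathfrak{A}$, $m_2:\mathfrak{A}_2\to\mathfrak{A}$ with $m_1\circ e_1=m_2\circ e_2$ such that whenever $\{j,k\}=\{1,2\}$, $a\in A_j$, $b\in A_k$ and $m_j(a)\le m_k(b)$, there is $c\in A_0$ with $a\le e_j(c)$ and $e_k(c)\le b$.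
   Formalization: Models and varieties are taken among algebras with 0 ≠ 1: the one-element algebra satisfies every equation but is not in Drs_α, since units V are nonempty, so "variety" and (1) would be false if it counted as a model. -}

module Defs where

open import Axiom.ExcludedMiddle using (ExcludedMiddle)
open import Data.Bool.Base using (Bool; true; false; if_then_else_)
open import Data.Empty.Polymorphic using (⊥)
open import Data.Fin.Base using (Fin)
open import Data.List.Base using (List)
import Data.List.Membership.Propositional as ListMembership
import Data.List.Membership.Setoid as SetoidMembership
open import Data.Nat.Base using (ℕ)
open import Data.Product.Base using (Σ; Σ-syntax; ∃; ∃₂; _×_; _,_; proj₁; proj₂)
open import Data.Sum.Base using (_⊎_; [_,_]′)
open import Data.Sum.Base as Sum using ()
open import Function.Base using (_∘_; id)
open import Function.Bundles using (Func)
open import Function.Definitions using (Congruent; Injective; Surjective)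
open import Induction.WellFounded using (WellFounded)
open import Level using (Level; _⊔_; suc)
open import Relation.Binary.Bundles using (Setoid)
open import Relation.Binary.Core using (Rel; REL)
open import Relation.Binary.Structures using (IsEquivalence; IsStrictTotalOrder)
open import Relation.Binary.PropositionalEquality.Core using (_≡_)
import Relation.Binary.PropositionalEquality.Properties as ≡
open import Relation.Nullary.Decidable.Core using (does)
open import Relation.Nullary.Negation.Core using (¬_)
open import Relation.Nullary.Reflects using (Reflects)
open import Relation.Unary using (Pred; _⊆_; _≐_; U)

private
  variable
    a b a′ b′ p s ι κ : Level

-- Sets are setoids here, so choice has to provide a function that respects
-- the equalities (for types with no equality imposed, choice is just the
-- second projection of Σ).
ExtensionalChoice : ∀ ℓ → Set (suc ℓ)
ExtensionalChoice ℓ =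
  (A B : Setoid ℓ ℓ) →
  let module A = Setoid A
      module B = Setoid B
  in
  (R : REL A.Carrier B.Carrier ℓ) →
  (∀ {x x′ y y′} → x A.≈ x′ → y B.≈ y′ → R x y → R x′ y′) →
  (∀ x → ∃ λ y → R x y) →
  Σ[ f ∈ Func A B ] (∀ x → R x (Func.to f x))

record Classical (ℓ : Level) : Set (suc (suc ℓ)) where
  field
    excludedMiddle : ExcludedMiddle (suc ℓ)
    choice         : ExtensionalChoice (suc ℓ)

record Ordinal (ℓ : Level) : Set (suc ℓ) where
  infix 4 _<_
  field
    Carrier            : Set ℓ
    _<_                : Rel Carrier ℓ
    isStrictTotalOrder : IsStrictTotalOrder _≡_ _<_
    wellFounded        : WellFounded _<_

  open IsStrictTotalOrder isStrictTotalOrder public using (_≟_)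

  setoid : Setoid ℓ ℓ
  setoid = ≡.setoid Carrier

2≤_ : ∀ {ℓ} → Ordinal ℓ → Set ℓ
2≤ α = ∃₂ λ (i j : Ordinal.Carrier α) → Ordinal._<_ α i j

Finite : (S : Setoid a b) → Pred (Setoid.Carrier S) p → Set (a ⊔ b ⊔ p)
Finite S P = Σ[ xs ∈ List (Setoid.Carrier S) ] (∀ {x} → P x → x ∈ xs)
  where open SetoidMembership S using (_∈_)

FiniteOrdinal : ∀ {ℓ} → Ordinal ℓ → Set ℓ
FiniteOrdinal α = Finite (Ordinal.setoid α) U

record Algebra (I : Set ι) (a b : Level) : Set (ι ⊔ suc (a ⊔ b)) where
  infix  4 _≈_ _≤_
  infixl 7 _·_
  infixl 6 _+_
  infix  8 -_
  field
    Carrier       : Set a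
    _≈_           : Rel Carrier b
    isEquivalence : IsEquivalence _≈_
    _·_ _+_       : Carrier → Carrier → Carrier
    -_            : Carrier → Carrier
    0# 1#         : Carrier
    c             : I → Carrier → Carrier
    ·-cong        : ∀ {x x′ y y′} → x ≈ x′ → y ≈ y′ → x · y ≈ x′ · y′
    +-cong        : ∀ {x x′ y y′} → x ≈ x′ → y ≈ y′ → x + y ≈ x′ + y′
    -‿cong        : ∀ {x x′} → x ≈ x′ → - x ≈ - x′
    c-cong        : ∀ i {x x′} → x ≈ x′ → c i x ≈ c i x′

  _≤_ : Rel Carrier b
  x ≤ y = x · y ≈ x

module _ {I : Set ι} where

  record IsHomomorphism (𝔄 : Algebra I a b) (𝔅 : Algebra I a′ b′)
                        (h : Algebra.Carrier 𝔄 → Algebra.Carrier 𝔅)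
                        : Set (ι ⊔ a ⊔ b ⊔ b′) where
    private
      module A = Algebra 𝔄
      module B = Algebra 𝔅
    field
      cong   : Congruent A._≈_ B._≈_ h
      ·-homo : ∀ x y → h (x A.· y) B.≈ h x B.· h y
      +-homo : ∀ x y → h (x A.+ y) B.≈ h x B.+ h y
      -‿homo : ∀ x → h (A.- x) B.≈ B.- h x
      0-homo : h A.0# B.≈ B.0#
      1-homo : h A.1# B.≈ B.1#
      c-homo : ∀ i x → h (A.c i x) B.≈ B.c i (h x)

  record Embedding (𝔄 : Algebra I a b) (𝔅 : Algebra I a′ b′)
                   : Set (ι ⊔ a ⊔ b ⊔ a′ ⊔ b′) where
    field
      to             : Algebra.Carrier 𝔄 → Algebra.Carrier 𝔅
      isHomomorphism : IsHomomorphism 𝔄 𝔅 to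
      injective      : Injective (Algebra._≈_ 𝔄) (Algebra._≈_ 𝔅) to

  record Isomorphism (𝔄 : Algebra I a b) (𝔅 : Algebra I a′ b′)
                     : Set (ι ⊔ a ⊔ b ⊔ a′ ⊔ b′) where
    field
      embedding  : Embedding 𝔄 𝔅
    open Embedding embedding public
    field
      surjective : Surjective (Algebra._≈_ 𝔄) (Algebra._≈_ 𝔅) to

  record Subuniverse (𝔅 : Algebra I a b) (s : Level)
                     : Set (ι ⊔ a ⊔ b ⊔ suc s) where
    open Algebra 𝔅
    field
      Member   : Pred Carrier s
      resp     : ∀ {x y} → x ≈ y → Member x → Member y
      ·-closed : ∀ {x y} → Member x → Member y → Member (x · y)
      +-closed : ∀ {x y} → Member x → Member y → Member (x + y)
      -‿closed : ∀ {x} → Member x → Member (- x)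
      0-closed : Member 0#
      1-closed : Member 1#
      c-closed : ∀ i {x} → Member x → Member (c i x)

  subalgebra : (𝔅 : Algebra I a b) → Subuniverse 𝔅 s → Algebra I (a ⊔ s) b
  subalgebra 𝔅 S = record
    { Carrier       = Σ Carrier Member
    ; _≈_           = λ x y → proj₁ x ≈ proj₁ y
    ; isEquivalence = record { refl = E.refl ; sym = E.sym ; trans = E.trans }
    ; _·_           = λ (x , p) (y , q) → x · y , ·-closed p q
    ; _+_           = λ (x , p) (y , q) → x + y , +-closed p q
    ; -_            = λ (x , p) → - x , -‿closed p
    ; 0#            = 0# , 0-closed
    ; 1#            = 1# , 1-closed
    ; c             = λ i (x , p) → c i x , c-closed i p
    ; ·-cong        = ·-cong
    ; +-cong        = +-cong
    ; -‿cong        = -‿cong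
    ; c-cong        = λ i → c-cong i
    }
    where
    open Algebra 𝔅
    open Subuniverse S
    module E = IsEquivalence isEquivalence

data Term (I : Set ι) : Set ι where
  var       : ℕ → Term I
  _·ᵗ_ _+ᵗ_ : Term I → Term I → Term I
  -ᵗ_       : Term I → Term I
  0ᵗ 1ᵗ     : Term I
  cᵗ        : I → Term I → Term I

infix 4 _≈ᵗ_

data Equation (I : Set ι) : Set ι where
  _≈ᵗ_ : Term I → Term I → Equation I

renameTerm : {I : Set ι} {J : Set κ} → (I → J) → Term I → Term J
renameTerm ρ (var n)  = var n
renameTerm ρ (t ·ᵗ u) = renameTerm ρ t ·ᵗ renameTerm ρ u
renameTerm ρ (t +ᵗ u) = renameTerm ρ t +ᵗ renameTerm ρ u
renameTerm ρ (-ᵗ t)   = -ᵗ renameTerm ρ t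
renameTerm ρ 0ᵗ       = 0ᵗ
renameTerm ρ 1ᵗ       = 1ᵗ
renameTerm ρ (cᵗ i t) = cᵗ (ρ i) (renameTerm ρ t)

rename : {I : Set ι} {J : Set κ} → (I → J) → Equation I → Equation J
rename ρ (t ≈ᵗ u) = renameTerm ρ t ≈ᵗ renameTerm ρ u

-- An equation together with the number of its index metavariables.
Schema : Set
Schema = Σ[ n ∈ ℕ ] Equation (Fin n)

module _ {I : Set ι} where

  ⟦_⟧ : Term I → (𝔄 : Algebra I a b) →
        (ℕ → Algebra.Carrier 𝔄) → Algebra.Carrier 𝔄
  ⟦ t ⟧ 𝔄 v = eval t
    where
    open Algebra 𝔄
    eval : Term I → Carrier
    eval (var n)  = v n
    eval (t ·ᵗ u) = eval t · eval u
    eval (t +ᵗ u) = eval t + eval u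
    eval (-ᵗ t)   = - eval t
    eval 0ᵗ       = 0#
    eval 1ᵗ       = 1#
    eval (cᵗ i t) = c i (eval t)

  infix 4 _⊨_

  _⊨_ : Algebra I a b → Equation I → Set (a ⊔ b)
  𝔄 ⊨ (t ≈ᵗ u) = ∀ v → Algebra._≈_ 𝔄 (⟦ t ⟧ 𝔄 v) (⟦ u ⟧ 𝔄 v)

  Nondegenerate : Algebra I a b → Set b
  Nondegenerate 𝔄 = ¬ (0# ≈ 1#)
    where open Algebra 𝔄

  -- One-element algebras satisfy every equation but are not isomorphic to
  -- set algebras with nonempty unit, so they are not counted as models.
  Mod : Pred (Equation I) s → Pred (Algebra I a b) (ι ⊔ a ⊔ b ⊔ s)
  Mod Γ 𝔄 = Nondegenerate 𝔄 × (∀ {e} → Γ e → 𝔄 ⊨ e)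

  listed : List (Equation I) → Pred (Equation I) ι
  listed es e = e ∈ es
    where open ListMembership

  InstanceOf : List Schema → Pred (Equation I) ι
  InstanceOf σs e =
    Σ[ σ ∈ Schema ] σ ∈ σs ×
    Σ[ ρ ∈ (Fin (proj₁ σ) → I) ] Injective _≡_ _≡_ ρ × e ≡ rename ρ (proj₂ σ)
    where open ListMembership

  FinitelyAxiomatizable : Pred (Algebra I a b) p → Set (suc (a ⊔ b) ⊔ ι ⊔ p)
  FinitelyAxiomatizable K = Σ[ es ∈ List (Equation I) ] K ≐ Mod (listed es)

  FiniteSchemaAxiomatizable : Pred (Algebra I a b) p → Set (suc (a ⊔ b) ⊔ ι ⊔ p)
  FiniteSchemaAxiomatizable K = Σ[ σs ∈ List Schema ] K ≐ Mod (InstanceOf σs)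

  IsVariety : Pred (Algebra I a b) p → Set (suc (a ⊔ b ⊔ ι) ⊔ p)
  IsVariety {p = p} K = Σ[ Γ ∈ Pred (Equation I) ι ] K ≐ Mod Γ

  -- K is the least variety containing G.
  GeneratedAsVarietyBy : Pred (Algebra I a b) p → Pred (Algebra I a b) s →
                         Set (suc (a ⊔ b ⊔ ι) ⊔ p ⊔ s)
  GeneratedAsVarietyBy K G =
    IsVariety K × G ⊆ K ×
    (∀ (Γ : Pred (Equation I) ι) → G ⊆ Mod Γ → K ⊆ Mod Γ)

  Valid : Pred (Algebra I a b) p → Equation I → Set (suc (a ⊔ b) ⊔ ι ⊔ p)
  Valid K e = ∀ 𝔄 → K 𝔄 → 𝔄 ⊨ e

  -- The deciding function must be given without appeal to the classical
  -- principles, which may only be used to prove it correct; if they could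
  -- be used to define it, every set of equations would be decidable.
  DecidableEquationalTheory : (ℓ : Level) → Pred (Algebra I a b) p →
                              Set (suc (suc ℓ) ⊔ suc (a ⊔ b) ⊔ ι ⊔ p)
  DecidableEquationalTheory ℓ K =
    Σ[ decide ∈ (Equation I → Bool) ]
      (Classical ℓ → ∀ e → Reflects (Valid K e) (decide e))

  Interpolates : (𝔄₀ 𝔄₁ 𝔄₂ 𝔄 : Algebra I a b) →
                 Embedding 𝔄₀ 𝔄₁ → Embedding 𝔄₀ 𝔄₂ →
                 Embedding 𝔄₁ 𝔄 → Embedding 𝔄₂ 𝔄 → Set (a ⊔ b)
  Interpolates 𝔄₀ 𝔄₁ 𝔄₂ 𝔄 e₁ e₂ m₁ m₂ =
    ∀ x y → to m₁ x ≤ to m₂ y →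
    ∃ λ z → (x ≤₁ to e₁ z) × (to e₂ z ≤₂ y)
    where
    open Embedding
    open Algebra 𝔄 using (_≤_)
    open Algebra 𝔄₁ using () renaming (_≤_ to _≤₁_)
    open Algebra 𝔄₂ using () renaming (_≤_ to _≤₂_)

  SuperAmalgamation : Pred (Algebra I a b) p → Set (suc (a ⊔ b) ⊔ ι ⊔ p)
  SuperAmalgamation {a} {b} K =
    ∀ (𝔄₀ 𝔄₁ 𝔄₂ : Algebra I a b) → K 𝔄₀ → K 𝔄₁ → K 𝔄₂ →
    (e₁ : Embedding 𝔄₀ 𝔄₁) (e₂ : Embedding 𝔄₀ 𝔄₂) →
    Σ[ 𝔄 ∈ Algebra I a b ] K 𝔄 ×
    Σ[ m₁ ∈ Embedding 𝔄₁ 𝔄 ] Σ[ m₂ ∈ Embedding 𝔄₂ 𝔄 ]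
      (∀ x → Algebra._≈_ 𝔄 (to m₁ (to e₁ x)) (to m₂ (to e₂ x))) ×
      Interpolates 𝔄₀ 𝔄₁ 𝔄₂ 𝔄 e₁ e₂ m₁ m₂ ×
      Interpolates 𝔄₀ 𝔄₂ 𝔄₁ 𝔄 e₂ e₁ m₂ m₁
    where open Embedding using (to)

module _ {ℓ : Level} (α : Ordinal ℓ) where

  private
    module α = Ordinal α

  Alg : (a b : Level) → Set (ℓ ⊔ suc (a ⊔ b))
  Alg = Algebra α.Carrier

  module Sequences (𝑈 : Setoid ℓ ℓ) where
    private module 𝑈 = Setoid 𝑈

    Seq : Set ℓ
    Seq = α.Carrier → 𝑈.Carrier

    infix 4 _≋_ _≡[_]_

    _≋_ : Rel Seq ℓ
    f ≋ g = ∀ j → f j 𝑈.≈ g j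

    _[_≔_] : Seq → α.Carrier → 𝑈.Carrier → Seq
    (f [ i ≔ u ]) j = if does (j α.≟ i) then u else f j

    _≡[_]_ : Seq → α.Carrier → Seq → Set ℓ
    f ≡[ i ] g = ∃ λ u → g ≋ (f [ i ≔ u ])

  record Unit (𝑈 : Setoid ℓ ℓ) : Set (suc ℓ) where
    open Sequences 𝑈
    field
      V        : Pred Seq ℓ
      resp     : ∀ {f g} → f ≋ g → V f → V g
      nonempty : ∃ V

  module _ {𝑈 : Setoid ℓ ℓ} (unit : Unit 𝑈) where
    private module 𝑈 = Setoid 𝑈
    open Sequences 𝑈
    open Unit unit

    record Subset : Set (suc ℓ) where
      field
        Member : Pred Seq ℓ
        ⊆V     : Member ⊆ V
        respᴹ  : ∀ {f g} → f ≋ g → Member f → Member g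

    open Subset

    𝔓 : Alg (suc ℓ) ℓ
    𝔓 = record
      { Carrier       = Subset
      ; _≈_           = λ X Y → Member X ≐ Member Y
      ; isEquivalence = record
        { refl  = id , id
        ; sym   = λ (p , q) → q , p
        ; trans = λ (p , q) (p′ , q′) → p′ ∘ p , q ∘ q′
        }
      ; _·_           = λ X Y → record
        { Member = λ f → Member X f × Member Y f
        ; ⊆V     = λ (x , _) → ⊆V X x
        ; respᴹ  = λ eq (x , y) → respᴹ X eq x , respᴹ Y eq y
        }
      ; _+_           = λ X Y → record
        { Member = λ f → Member X f ⊎ Member Y f
        ; ⊆V     = [ ⊆V X , ⊆V Y ]′
        ; respᴹ  = λ eq → Sum.map (respᴹ X eq) (respᴹ Y eq)
        }
      ; -_            = λ X → record
        { Member = λ f → V f × ¬ Member X f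
        ; ⊆V     = proj₁
        ; respᴹ  = λ eq (v , ¬x) →
            resp eq v , λ x → ¬x (respᴹ X (λ j → 𝑈.sym (eq j)) x)
        }
      ; 0#            = record
        { Member = λ _ → ⊥ ; ⊆V = λ () ; respᴹ = λ _ () }
      ; 1#            = record
        { Member = V ; ⊆V = id ; respᴹ = resp }
      ; c             = λ i Y → record
        { Member = λ f → V f × (∃ λ g → Member Y g × f ≡[ i ] g)
        ; ⊆V     = proj₁
        ; respᴹ  = λ eq (v , g , y , u , g≋) →
            resp eq v , g , y , u , λ j → 𝑈.trans (g≋ j) (update-cong eq i u j)
        }
      ; ·-cong        = λ (p , q) (p′ , q′) →
          (λ (x , y) → p x , p′ y) , (λ (x , y) → q x , q′ y)
      ; +-cong        = λ (p , q) (p′ , q′) → Sum.map p p′ , Sum.map q q′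
      ; -‿cong        = λ (p , q) →
          (λ (v , ¬x) → v , ¬x ∘ q) , (λ (v , ¬x) → v , ¬x ∘ p)
      ; c-cong        = λ i (p , q) →
          (λ (v , g , y , r) → v , g , p y , r) ,
          (λ (v , g , y , r) → v , g , q y , r)
      }
      where
      update-cong : ∀ {f g} → f ≋ g → ∀ i u → (f [ i ≔ u ]) ≋ (g [ i ≔ u ])
      update-cong eq i u j with does (j α.≟ i)
      ... | true  = 𝑈.refl
      ... | false = eq j

    -- The smallest set containing all values of the sequences in V.
    Base : Pred 𝑈.Carrier ℓ
    Base u = ∃ λ f → V f × ∃ λ i → u 𝑈.≈ f i

    V⊆Base : ∀ {f} → V f → ∀ i → Base (f i)
    V⊆Base {f} v i = f , v , i , 𝑈.refl

    Base-smallest : (W : Pred 𝑈.Carrier p) → (∀ {u w} → u 𝑈.≈ w → W w → W u) →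
                    (∀ {f} → V f → ∀ i → W (f i)) → Base ⊆ W
    Base-smallest W W-resp V⊆W (f , v , i , u≈fi) = W-resp u≈fi (V⊆W v i)

  record Representation (𝔄 : Alg ℓ ℓ) : Set (suc (suc ℓ)) where
    field
      space       : Setoid ℓ ℓ
      unit        : Unit space
      subuniverse : Subuniverse (𝔓 unit) ℓ
      isomorphism : Isomorphism 𝔄 (subalgebra (𝔓 unit) subuniverse)

  Drs : Pred (Alg ℓ ℓ) (suc (suc ℓ))
  Drs = Representation

  FiniteBaseDrs : Pred (Alg ℓ ℓ) (suc (suc ℓ))
  FiniteBaseDrs 𝔄 = Σ[ R ∈ Representation 𝔄 ]
    Finite (Representation.space R) (Base (Representation.unit R))

  Δ : (𝔄 : Alg a b) → Algebra.Carrier 𝔄 → Pred α.Carrier b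
  Δ 𝔄 x i = ¬ (c i x ≈ x)
    where open Algebra 𝔄

  LocallyFinite : Pred (Alg a b) (ℓ ⊔ a ⊔ b)
  LocallyFinite 𝔄 = ∀ x → Finite α.setoid (Δ 𝔄 x)

  LocallyFiniteDrs : Pred (Alg ℓ ℓ) (suc (suc ℓ))
  LocallyFiniteDrs 𝔄 = Drs 𝔄 × LocallyFinite 𝔄

{-# OPTIONS --safe #-}
module Submission where

-- An algebra is in Drs α iff it embeds into the complex algebra of a frame
-- with one equivalence relation per index, i.e. iff it is a nondegenerate
-- Boolean algebra with complemented closure operators. Such an algebra embeds
-- into the complex algebra of its ultrafilter frame, and any frame is covered
-- by the tree of its reduced labelled paths, which is isomorphic to a set of
-- sequences because distinct paths are never related by two different indices.
--
-- An equation refutable in Drs α is refuted in a finite filtration of a frame,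
-- so refutability is decided by a search through finite quasimodels. Cutting
-- the tree of a quasimodel at the depth of the equation, and using only the
-- indices of the equation as labels, leaves a refuting algebra that has a
-- finite base and is locally finite dimensional.
--
-- Super amalgamation holds because the pairs of ultrafilters of 𝔄₁ and 𝔄₂ with
-- the same restriction to 𝔄₀ form a frame whose projections onto both
-- ultrafilter frames are surjective bounded morphisms.

open import Algebra.Lattice.Bundles using (BooleanAlgebra)
open import Algebra.Lattice.Structures using (IsBooleanAlgebra)
open import Algebra.Lattice.Structures.Biased using (isBooleanAlgebraʳ; isDistributiveLatticeʳʲᵐ)
import Algebra.Lattice.Properties.BooleanAlgebra as BooleanAlgebraProperties
open import Axiom.ExcludedMiddle using (ExcludedMiddle)
open import Data.Bool.Base using (Bool; true; false; not; _∧_; _∨_; if_then_else_)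
import Data.Bool.Properties as Bool
open import Data.Empty using (⊥-elim)
open import Data.Fin.Base using (zero)
open import Data.List.Base using (List; []; _∷_; _++_; map; filter; concatMap; cartesianProduct; cartesianProductWith)
open import Data.List.Membership.Propositional using (_∈_; find; lose)
open import Data.List.Membership.Propositional.Properties
open import Data.List.Relation.Unary.All as All using (All; []; _∷_)
open import Data.List.Relation.Unary.Any as Any using (Any; here; there)
open import Data.Nat.Base as ℕ using (ℕ; z≤n; s≤s)
import Data.Nat.Properties as ℕ
open import Data.Product.Base using (Σ-syntax; ∃; ∃₂; _×_; _,_; proj₁; proj₂; swap)
open import Data.Sum.Base as Sum using (_⊎_; inj₁; inj₂; [_,_]′)
open import Data.Unit.Polymorphic.Base using (⊤; tt)
open import Data.Vec.Base using (Vec; []; _∷_)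
open import Defs
open import Function.Base using (_∘_; id; flip; const)
open import Function.Bundles using (Func; mk⇔)
open import Level using (Level; Lift; lift; lower; suc; _⊔_)
open import Relation.Binary.Bundles using (Setoid)
open import Relation.Binary.PropositionalEquality
  using (_≡_; _≢_; refl; sym; trans; cong; cong₂; subst; module ≡-Reasoning)
import Relation.Binary.PropositionalEquality.Properties as ≡
import Relation.Binary.Reasoning.Setoid as SetoidReasoning
open import Relation.Binary.Structures using (IsEquivalence; IsStrictTotalOrder)
open import Relation.Nullary.Decidable.Core using (Dec; yes; no; does; map′; _×-dec_; _⊎-dec_; _→-dec_; ¬?; decidable-stable)
open import Relation.Nullary.Decidable using (dec-true; dec-false; does-⇔)
open import Relation.Nullary.Negation.Core using (¬_; contradiction)
open import Relation.Nullary.Reflects using (Reflects; ofʸ; ofⁿ)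
open import Relation.Unary using (Pred; _⊆_)

-- No axiom links two different indices, so a frame may carry arbitrary, unrelated equivalence
-- relations. In a set of sequences, however, two sequences equivalent under two different indices
-- are equal; this is the obstacle that unravelling removes. Sizes shape the encoding. `𝔓` lives one
-- level above the algebras in `Drs`, so sets of worlds are Boolean functions and ultrafilters are
-- homomorphisms to `Bool`: the ultrafilter frame and its complex algebra then stay at level `ℓ`.
-- Excluded middle is taken one level higher, to turn the tower of the maximality argument into a
-- small index set. The decision procedure may use no classical principle. Quasimodels are therefore
-- finite lists of records of truth values whose conditions are decidable outright; classical
-- reasoning only shows that they refute exactly the equations failing in `Drs`. Relating two points
-- that agree on all cylindrifications with index `i` is an equivalence by its very form, so a
-- finite filtration is again a frame.

module _ {ι a b} {I : Set ι} (𝔄 : Algebra I a b) (v : ℕ → Algebra.Carrier 𝔄) where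

  open Algebra 𝔄

  -- The evaluator local to ⟦_⟧ carries the whole term as an extra parameter,
  -- so ⟦ cᵗ i t ⟧ does not unfold to an expression in ⟦ t ⟧. Unification gives
  -- it a name, with that parameter as first argument.
  mutual
    evalIn : Term I → Term I → Carrier
    evalIn = _

    evalIn-unfold : ∀ s → - evalIn (-ᵗ s) s ≡ ⟦ -ᵗ s ⟧ 𝔄 v
    -- Abstracting the whole term makes the constraint on the metavariable `evalIn` a pattern in
    -- distinct variables, which unification can solve.
    evalIn-unfold s with -ᵗ s
    ... | _ = refl

  -- The extra parameter never affects the result. Fixing it at the arbitrary value `0ᵗ` yields an
  -- evaluator that unfolds compositionally.
  eval : Term I → Carrier
  eval = evalIn 0ᵗ

  evalIn≡eval : ∀ s t → evalIn s t ≡ eval t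
  evalIn≡eval s (var n)  = refl
  evalIn≡eval s (t ·ᵗ u) = cong₂ _·_ (evalIn≡eval s t) (evalIn≡eval s u)
  evalIn≡eval s (t +ᵗ u) = cong₂ _+_ (evalIn≡eval s t) (evalIn≡eval s u)
  evalIn≡eval s (-ᵗ t)   = cong -_ (evalIn≡eval s t)
  evalIn≡eval s 0ᵗ       = refl
  evalIn≡eval s 1ᵗ       = refl
  evalIn≡eval s (cᵗ i t) = cong (c i) (evalIn≡eval s t)

  ⟦⟧≡eval : ∀ t → ⟦ t ⟧ 𝔄 v ≡ eval t
  ⟦⟧≡eval t = evalIn≡eval t t

module _ {ι a b} {I : Set ι} (𝔄 : Algebra I a b) where

  open Algebra 𝔄

  ⊨⇒eval : ∀ t u → 𝔄 ⊨ (t ≈ᵗ u) → ∀ v → eval 𝔄 v t ≈ eval 𝔄 v u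
  ⊨⇒eval t u t≈u v
    rewrite sym (⟦⟧≡eval 𝔄 v t) | sym (⟦⟧≡eval 𝔄 v u) = t≈u v

  eval⇒⊨ : ∀ t u → (∀ v → eval 𝔄 v t ≈ eval 𝔄 v u) → 𝔄 ⊨ (t ≈ᵗ u)
  eval⇒⊨ t u t≈u v rewrite ⟦⟧≡eval 𝔄 v t | ⟦⟧≡eval 𝔄 v u = t≈u v

-- Homomorphisms, embeddings and reflection of equations.

module _ {ι a b a′ b′} {I : Set ι} {𝔄 : Algebra I a b} {𝔅 : Algebra I a′ b′} where

  private
    module A = Algebra 𝔄
    module B = Algebra 𝔅
    module A≈ = IsEquivalence A.isEquivalence
    module B≈ = IsEquivalence B.isEquivalence

  homo-eval : ∀ {h} → IsHomomorphism 𝔄 𝔅 h → ∀ v t →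
              h (eval 𝔄 v t) B.≈ eval 𝔅 (h ∘ v) t
  homo-eval {h} isHomo v = go
    where
    open IsHomomorphism isHomo
    go : ∀ t → h (eval 𝔄 v t) B.≈ eval 𝔅 (h ∘ v) t
    go (var n)  = B≈.refl
    go (t ·ᵗ u) = B≈.trans (·-homo _ _) (B.·-cong (go t) (go u))
    go (t +ᵗ u) = B≈.trans (+-homo _ _) (B.+-cong (go t) (go u))
    go (-ᵗ t)   = B≈.trans (-‿homo _) (B.-‿cong (go t))
    go 0ᵗ       = 0-homo
    go 1ᵗ       = 1-homo
    go (cᵗ i t) = B≈.trans (c-homo i _) (B.c-cong i (go t))

  embedding-reflects-⊨ : Embedding 𝔄 𝔅 → ∀ e → 𝔅 ⊨ e → 𝔄 ⊨ e
  embedding-reflects-⊨ h (t ≈ᵗ u) 𝔅⊨e = eval⇒⊨ 𝔄 t u λ v → injective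
    (B≈.trans (homo-eval isHomomorphism v t)
      (B≈.trans (⊨⇒eval 𝔅 t u 𝔅⊨e (to ∘ v)) (B≈.sym (homo-eval isHomomorphism v u))))
    where open Embedding h

  embedding-reflects-nondegenerate : Embedding 𝔄 𝔅 → Nondegenerate 𝔅 → Nondegenerate 𝔄
  embedding-reflects-nondegenerate h 0≉1 0≈1 =
    0≉1 (B≈.trans (B≈.sym 0-homo) (B≈.trans (cong′ 0≈1) 1-homo))
    where open IsHomomorphism (Embedding.isHomomorphism h) renaming (cong to cong′)

idᵉ : ∀ {ι a b} {I : Set ι} {𝔄 : Algebra I a b} → Embedding 𝔄 𝔄
idᵉ {𝔄 = 𝔄} = record
  { to             = id
  ; isHomomorphism = record
    { cong   = id
    ; ·-homo = λ _ _ → A≈.refl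
    ; +-homo = λ _ _ → A≈.refl
    ; -‿homo = λ _ → A≈.refl
    ; 0-homo = A≈.refl
    ; 1-homo = A≈.refl
    ; c-homo = λ _ _ → A≈.refl
    }
  ; injective      = id
  }
  where module A≈ = IsEquivalence (Algebra.isEquivalence 𝔄)

infixr 9 _∘ᵉ_

_∘ᵉ_ : ∀ {ι a b a′ b′ a″ b″} {I : Set ι}
       {𝔄 : Algebra I a b} {𝔅 : Algebra I a′ b′} {ℭ : Algebra I a″ b″} →
       Embedding 𝔅 ℭ → Embedding 𝔄 𝔅 → Embedding 𝔄 ℭ
_∘ᵉ_ {ℭ = ℭ} g f = record
  { to             = G.to ∘ F.to
  ; isHomomorphism = record
    { cong   = GH.cong ∘ FH.cong
    ; ·-homo = λ x y → C.trans (GH.cong (FH.·-homo x y)) (GH.·-homo _ _)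
    ; +-homo = λ x y → C.trans (GH.cong (FH.+-homo x y)) (GH.+-homo _ _)
    ; -‿homo = λ x → C.trans (GH.cong (FH.-‿homo x)) (GH.-‿homo _)
    ; 0-homo = C.trans (GH.cong FH.0-homo) GH.0-homo
    ; 1-homo = C.trans (GH.cong FH.1-homo) GH.1-homo
    ; c-homo = λ i x → C.trans (GH.cong (FH.c-homo i x)) (GH.c-homo i _)
    }
  ; injective      = F.injective ∘ G.injective
  }
  where
  module F  = Embedding f
  module G  = Embedding g
  module FH = IsHomomorphism F.isHomomorphism
  module GH = IsHomomorphism G.isHomomorphism
  module C  = IsEquivalence (Algebra.isEquivalence ℭ)

-- Boolean truth values, frames and complex algebras.

does-true⁻ : ∀ {p} {P : Set p} (P? : Dec P) → does P? ≡ true → P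
does-true⁻ (yes p) _ = p

∧-true⁻ : ∀ {x y} → x ∧ y ≡ true → x ≡ true × y ≡ true
∧-true⁻ {true} {true} _ = refl , refl

∨-true⁻ : ∀ {x y} → x ∨ y ≡ true → x ≡ true ⊎ y ≡ true
∨-true⁻ {true}  _   = inj₁ refl
∨-true⁻ {false} y≡t = inj₂ y≡t

∨-true⁺ˡ : ∀ {x y} → x ≡ true → x ∨ y ≡ true
∨-true⁺ˡ refl = refl

∨-true⁺ʳ : ∀ x {y} → y ≡ true → x ∨ y ≡ true
∨-true⁺ʳ x refl = Bool.∨-zeroʳ x

not-true⁻ : ∀ {x} → not x ≡ true → x ≢ true
not-true⁻ {false} _ ()

-- Only worlds in `Domain` count in the complex algebra. With a predicate instead of a subtype,
-- worlds carry no membership proofs that would have to be identified.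
record Frame {ℓ} (I : Set ℓ) : Set (suc ℓ) where
  field
    World           : Set ℓ
    Domain          : Pred World ℓ
    _∼[_]_          : World → I → World → Set ℓ
    ∼-isEquivalence : ∀ i → IsEquivalence _∼[ i ]_

  module ∼ {i : I} = IsEquivalence (∼-isEquivalence i)

-- Truth values are Booleans, and predicates on sets of truth values are
-- therefore small, so that power sets of small sets are small.
module Complex {ℓ} (em : ExcludedMiddle (suc ℓ)) where

  em↓ : ExcludedMiddle ℓ
  em↓ = map′ lower lift em

  ⌊_⌋ : Set ℓ → Bool
  ⌊ P ⌋ = does (em↓ {P})

  ⌊⌋⁺ : ∀ {P} → P → ⌊ P ⌋ ≡ true
  ⌊⌋⁺ = dec-true em↓

  ⌊⌋⁻ : ∀ {P} → ⌊ P ⌋ ≡ true → P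
  ⌊⌋⁻ = does-true⁻ em↓

  ⌊⌋-ext : ∀ {P Q} → (P → Q) → (Q → P) → ⌊ P ⌋ ≡ ⌊ Q ⌋
  ⌊⌋-ext f g = Bool.⇔→≡ (mk⇔ (⌊⌋⁺ ∘ f ∘ ⌊⌋⁻) (⌊⌋⁺ ∘ g ∘ ⌊⌋⁻))

  module _ {I : Set ℓ} (F : Frame I) where

    open Frame F

    ◇ : I → (World → Bool) → World → Bool
    ◇ i X w = ⌊ ∃ (λ v → Domain v × w ∼[ i ] v × X v ≡ true) ⌋

    ◇⁻ : ∀ {i X w} → ◇ i X w ≡ true → ∃ λ v → Domain v × w ∼[ i ] v × X v ≡ true
    ◇⁻ = ⌊⌋⁻

    Cm : Algebra I ℓ ℓ
    Cm = record
      { Carrier       = World → Bool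
      ; _≈_           = λ X Y → ∀ w → Domain w → X w ≡ Y w
      ; isEquivalence = record
        { refl  = λ _ _ → refl
        ; sym   = λ p w d → sym (p w d)
        ; trans = λ p q w d → trans (p w d) (q w d)
        }
      ; _·_           = λ X Y w → X w ∧ Y w
      ; _+_           = λ X Y w → X w ∨ Y w
      ; -_            = λ X w → not (X w)
      ; 0#            = λ _ → false
      ; 1#            = λ _ → true
      ; c             = ◇
      ; ·-cong        = λ p q w d → cong₂ _∧_ (p w d) (q w d)
      ; +-cong        = λ p q w d → cong₂ _∨_ (p w d) (q w d)
      ; -‿cong        = λ p w d → cong not (p w d)
      ; c-cong        = λ i p w _ → ⌊⌋-ext
          (λ (v , d , r , x) → v , d , r , trans (sym (p v d)) x)
          (λ (v , d , r , x) → v , d , r , trans (p v d) x)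
      }

    Cm-nondegenerate : ∃ Domain → Nondegenerate Cm
    Cm-nondegenerate (w , d) 0≈1 with () ← 0≈1 w d

    ¬⊨⇒countermodel : ∀ t u → ¬ (Cm ⊨ (t ≈ᵗ u)) →
                      ∃₂ λ v w → Domain w × eval Cm v t w ≢ eval Cm v u w
    ¬⊨⇒countermodel t u ¬e = decidable-stable em↓ λ ¬∃ →
      ¬e (eval⇒⊨ Cm t u λ v w d → decidable-stable (_ Bool.≟ _) λ t≢u → ¬∃ (v , w , d , t≢u))

-- Algebras of sets of sequences as complex algebras.

module _ {ℓ} (α : Ordinal ℓ) where

  private module α = Ordinal α

  image : ∀ {a b} {𝔄 : Alg α ℓ b} {𝔅 : Alg α a ℓ} → Embedding 𝔄 𝔅 → Subuniverse 𝔅 ℓ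
  image {𝔄 = 𝔄} {𝔅} h = record
    { Member   = λ y → ∃ λ x → to x B.≈ y
    ; resp     = λ y≈z (x , x≈y) → x , B≈.trans x≈y y≈z
    ; ·-closed = λ (x , p) (y , q) → x A.· y , B≈.trans (·-homo x y) (B.·-cong p q)
    ; +-closed = λ (x , p) (y , q) → x A.+ y , B≈.trans (+-homo x y) (B.+-cong p q)
    ; -‿closed = λ (x , p) → A.- x , B≈.trans (-‿homo x) (B.-‿cong p)
    ; 0-closed = A.0# , 0-homo
    ; 1-closed = A.1# , 1-homo
    ; c-closed = λ i (x , p) → A.c i x , B≈.trans (c-homo i x) (B.c-cong i p)
    }
    where
    module A = Algebra 𝔄
    module B = Algebra 𝔅
    module B≈ = IsEquivalence B.isEquivalence
    open Embedding h
    open IsHomomorphism isHomomorphism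

  module _ {𝔄 : Alg α ℓ ℓ} {𝑈 : Setoid ℓ ℓ} {unit : Unit α 𝑈} where

    embedding⇒representation : Embedding 𝔄 (𝔓 α unit) → Representation α 𝔄
    embedding⇒representation h = record
      { space       = 𝑈
      ; unit        = unit
      ; subuniverse = image h
      ; isomorphism = record
        { embedding  = record
          { to             = λ x → to x , x , id , id
          ; isHomomorphism = record
            { cong   = H.cong
            ; ·-homo = H.·-homo
            ; +-homo = H.+-homo
            ; -‿homo = H.-‿homo
            ; 0-homo = H.0-homo
            ; 1-homo = H.1-homo
            ; c-homo = H.c-homo
            }
          ; injective      = injective
          }
        ; surjective = λ (_ , x , p , q) → x , λ z≈x →
            let p′ , q′ = H.cong z≈x in p ∘ p′ , q′ ∘ q
        }
      }
      where
      open Embedding h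
      module H = IsHomomorphism isHomomorphism

  representation⇒embedding : ∀ {𝔄} (R : Representation α 𝔄) →
                             Embedding 𝔄 (𝔓 α (Representation.unit R))
  representation⇒embedding R = record
    { to             = proj₁ ∘ I.to
    ; isHomomorphism = record
      { cong   = H.cong
      ; ·-homo = H.·-homo
      ; +-homo = H.+-homo
      ; -‿homo = H.-‿homo
      ; 0-homo = H.0-homo
      ; 1-homo = H.1-homo
      ; c-homo = H.c-homo
      }
    ; injective      = I.injective
    }
    where
    module I = Isomorphism (Representation.isomorphism R)
    module H = IsHomomorphism I.isHomomorphism

  module _ (𝑈 : Setoid ℓ ℓ) where

    private module 𝑈 = Setoid 𝑈
    open Sequences α 𝑈

    ≡[]⇒agree : ∀ {f g i} → f ≡[ i ] g → ∀ j → j ≢ i → f j 𝑈.≈ g j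
    ≡[]⇒agree {i = i} (u , g≋) j j≢i with j α.≟ i | g≋ j
    ... | yes j≡i | _     = contradiction j≡i j≢i
    ... | no _    | gj≈fj = 𝑈.sym gj≈fj

    agree⇒≡[] : ∀ {f g i} → (∀ j → j ≢ i → f j 𝑈.≈ g j) → f ≡[ i ] g
    agree⇒≡[] {f} {g} {i} agree = g i , g≋
      where
      g≋ : g ≋ (f [ i ≔ g i ])
      g≋ j with j α.≟ i
      ... | yes refl = 𝑈.refl
      ... | no j≢i   = 𝑈.sym (agree j j≢i)

    -- The common form of a unit, where `f` is the identity, and of the tree of paths, where `f`
    -- lists the coordinates of a path.
    coordinateFrame : {W : Set ℓ} → Pred W ℓ → (W → Seq) → Frame α.Carrier
    coordinateFrame {W} D f = record
      { World           = W
      ; Domain          = D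
      ; _∼[_]_          = λ w i v → ∀ j → j ≢ i → f w j 𝑈.≈ f v j
      ; ∼-isEquivalence = λ i → record
        { refl  = λ _ _ → 𝑈.refl
        ; sym   = λ p j j≢i → 𝑈.sym (p j j≢i)
        ; trans = λ p q j j≢i → 𝑈.trans (p j j≢i) (q j j≢i)
        }
      }

module Representability {ℓ} (em : ExcludedMiddle (suc ℓ)) (α : Ordinal ℓ) where

  open Complex em
  private module α = Ordinal α

  module _ (𝑈 : Setoid ℓ ℓ) where

    private module 𝑈 = Setoid 𝑈
    open Sequences α 𝑈

    sequenceFrame : Unit α 𝑈 → Frame α.Carrier
    sequenceFrame unit = coordinateFrame α 𝑈 (Unit.V unit) id

    -- Excluded middle makes a subset of the unit the same thing as a Boolean function on its
    -- sequences, which replaces the large algebra `𝔓` by a small one.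
    characteristic : (unit : Unit α 𝑈) → Embedding (𝔓 α unit) (Cm (sequenceFrame unit))
    characteristic unit = record
      { to             = λ X f → ⌊ Member X f ⌋
      ; isHomomorphism = record
        { cong   = λ (X⊆Y , Y⊆X) f _ → ⌊⌋-ext X⊆Y Y⊆X
        ; ·-homo = λ X Y f _ → does-⇔ (mk⇔ id id) em↓ (em↓ ×-dec em↓)
        ; +-homo = λ X Y f _ → does-⇔ (mk⇔ id id) em↓ (em↓ ⊎-dec em↓)
        ; -‿homo = λ X f v → does-⇔ (mk⇔ proj₂ (v ,_)) em↓ (¬? em↓)
        ; 0-homo = λ f _ → dec-false em↓ λ ()
        ; 1-homo = λ f v → ⌊⌋⁺ v
        ; c-homo = λ i X f v → ⌊⌋-ext
            (λ (_ , g , x , f≡g) → g , ⊆V X x , ≡[]⇒agree α 𝑈 f≡g , ⌊⌋⁺ x)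
            (λ (g , _ , f∼g , x) → v , g , ⌊⌋⁻ x , agree⇒≡[] α 𝑈 f∼g)
        }
      ; injective      = λ {X} {Y} X≈Y →
          (λ {f} x → ⌊⌋⁻ (trans (sym (X≈Y f (⊆V X x))) (⌊⌋⁺ x))) ,
          (λ {f} y → ⌊⌋⁻ (trans (X≈Y f (⊆V Y y)) (⌊⌋⁺ y)))
      }
      where open Subset

    module _ {W : Set ℓ} (D : Pred W ℓ) (f : W → Seq) (nonempty : ∃ D) where

      imageUnit : Unit α 𝑈
      imageUnit = record
        { V        = λ g → ∃ λ w → D w × g ≋ f w
        ; resp     = λ g≋h (w , d , g≋) → w , d , λ j → 𝑈.trans (𝑈.sym (g≋h j)) (g≋ j)
        ; nonempty = let w , d = nonempty in f w , w , d , λ _ → 𝑈.refl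
        }

      module _ (f-injective : ∀ {w v} → D w → D v → f w ≋ f v → w ≡ v) where

        private
          same : ∀ {g w v} → D w → D v → g ≋ f w → g ≋ f v → w ≡ v
          same d d′ g≋ g≋′ = f-injective d d′ λ j → 𝑈.trans (𝑈.sym (g≋ j)) (g≋′ j)

          Im : (W → Bool) → Pred Seq ℓ
          Im X g = ∃ λ w → D w × g ≋ f w × X w ≡ true

          Im⁻ : ∀ X {w} → D w → Im X (f w) → X w ≡ true
          Im⁻ X d (v , d′ , fw≋ , x) =
            subst (λ v → X v ≡ true) (sym (same d d′ (λ _ → 𝑈.refl) fw≋)) x

        -- Injectivity of `f` means that a sequence in the unit comes from exactly one world of the
        -- domain. Without it the image of subsets need not preserve `·` and `-`.
        image-embedding : Embedding (Cm (coordinateFrame α 𝑈 D f)) (𝔓 α imageUnit)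
        image-embedding = record
          { to             = λ X → record
            { Member = Im X
            ; ⊆V     = λ (w , d , g≋ , _) → w , d , g≋
            ; respᴹ  = λ g≋h (w , d , g≋ , x) →
                w , d , (λ j → 𝑈.trans (𝑈.sym (g≋h j)) (g≋ j)) , x
            }
          ; isHomomorphism = record
            { cong   = λ X≈Y →
                (λ (w , d , g≋ , x) → w , d , g≋ , trans (sym (X≈Y w d)) x) ,
                (λ (w , d , g≋ , y) → w , d , g≋ , trans (X≈Y w d) y)
            ; ·-homo = λ X Y →
                (λ (w , d , g≋ , xy) → let x , y = ∧-true⁻ xy in
                  (w , d , g≋ , x) , (w , d , g≋ , y)) ,
                (λ ((w , d , g≋ , x) , (v , d′ , g≋′ , y)) →
                  w , d , g≋ , cong₂ _∧_ x (subst (λ v → Y v ≡ true) (sym (same d d′ g≋ g≋′)) y))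
            ; +-homo = λ X Y →
                (λ (w , d , g≋ , xy) → Sum.map (λ x → w , d , g≋ , x) (λ y → w , d , g≋ , y) (∨-true⁻ xy)) ,
                [ (λ (w , d , g≋ , x) → w , d , g≋ , ∨-true⁺ˡ x)
                , (λ (w , d , g≋ , y) → w , d , g≋ , ∨-true⁺ʳ (X w) y)
                ]′
            ; -‿homo = λ X →
                (λ (w , d , g≋ , ¬x) → (w , d , g≋) , λ (v , d′ , g≋′ , x) →
                  not-true⁻ ¬x (subst (λ v → X v ≡ true) (sym (same d d′ g≋ g≋′)) x)) ,
                (λ ((w , d , g≋) , ¬x) → w , d , g≋ ,
                  cong not (Bool.¬-not λ x → ¬x (w , d , g≋ , x)))
            ; 0-homo = (λ { (_ , _ , _ , ()) }) , λ ()
            ; 1-homo = (λ (w , d , g≋ , _) → w , d , g≋) , (λ (w , d , g≋) → w , d , g≋ , refl)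
            ; c-homo = λ i X →
                (λ (w , d , g≋ , x) → let v , d′ , w∼v , x′ = ⌊⌋⁻ x in
                  (w , d , g≋) , f v , (v , d′ , (λ _ → 𝑈.refl) , x′) ,
                  agree⇒≡[] α 𝑈 λ j j≢i → 𝑈.trans (g≋ j) (w∼v j j≢i)) ,
                (λ ((w , d , g≋) , h , (v , d′ , h≋ , x) , g≡h) → w , d , g≋ ,
                  ⌊⌋⁺ (v , d′ , (λ j j≢i →
                    𝑈.trans (𝑈.sym (g≋ j)) (𝑈.trans (≡[]⇒agree α 𝑈 g≡h j j≢i) (h≋ j))) , x))
            }
          ; injective      = λ {X} {Y} (X⊆Y , Y⊆X) w d → Bool.⇔→≡ (mk⇔
              (λ x → Im⁻ Y d (X⊆Y (w , d , (λ _ → 𝑈.refl) , x)))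
              (λ y → Im⁻ X d (Y⊆X (w , d , (λ _ → 𝑈.refl) , y))))
          }

  Drs⇒frame : ∀ {𝔄} → Drs α 𝔄 →
              Σ[ F ∈ Frame α.Carrier ] ∃ (Frame.Domain F) × Embedding 𝔄 (Cm F)
  Drs⇒frame R = sequenceFrame space unit , Unit.nonempty unit ,
                characteristic space unit ∘ᵉ representation⇒embedding α R
    where open Representation R

-- Unravelling: in the tree of paths of a frame, i-equivalence of two paths
-- means that they differ at most in a last step labelled i. If the j-th
-- coordinate of a path is its longest prefix ending in a step labelled j, this
-- says that the coordinates agree off i.
module Tree {ℓ} (α : Ordinal ℓ) (F : Frame (Ordinal.Carrier α))
            (Label : Pred (Ordinal.Carrier α) ℓ) (Length : Pred ℕ Level.zero) where

  open Frame F
  open import Data.Nat.Base using (_≤_)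
  private module α = Ordinal α

  infixl 5 _▹[_]_

  data Path : Set ℓ where
    root   : World → Path
    _▹[_]_ : Path → α.Carrier → World → Path

  end : Path → World
  end (root w)     = w
  end (_ ▹[ _ ] w) = w

  len : Path → ℕ
  len (root _)     = 0
  len (p ▹[ _ ] _) = ℕ.suc (len p)

  NotLast : α.Carrier → Path → Set ℓ
  NotLast i (root _)     = ⊤
  NotLast i (_ ▹[ k ] _) = k ≢ i

  -- `NotLast` forbids two consecutive steps with the same label: since the relations are
  -- transitive, the second would stay in the class already reached by the first. `Label` and
  -- `Length` are trivial for the full unravelling and cut out a finite part for truncation.
  Legal : Path → Set ℓ
  Legal (root w)     = Domain w × Length 0
  Legal (p ▹[ k ] w) = Legal p × Domain w × end p ∼[ k ] w × NotLast k p ×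
                       Label k × Length (ℕ.suc (len p))

  end-domain : ∀ p → Legal p → Domain (end p)
  end-domain (root _)     (d , _)     = d
  end-domain (_ ▹[ _ ] _) (_ , d , _) = d

  coordinate : Path → α.Carrier → Path
  -- A path without steps labelled `j` has its starting root as coordinate, so paths from different
  -- roots differ in every coordinate.
  coordinate (root w)     j = root w
  coordinate (p ▹[ k ] w) j = if does (j α.≟ k) then p ▹[ k ] w else coordinate p j

  coordinate-same : ∀ p k w → coordinate (p ▹[ k ] w) k ≡ p ▹[ k ] w
  coordinate-same p k w rewrite dec-true (k α.≟ k) refl = refl

  coordinate-other : ∀ p {j k} w → j ≢ k → coordinate (p ▹[ k ] w) j ≡ coordinate p j
  coordinate-other p {j} {k} w j≢k rewrite dec-false (j α.≟ k) j≢k = refl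

  coordinate-len : ∀ p j → len (coordinate p j) ≤ len p
  coordinate-len (root w)     j = z≤n
  coordinate-len (p ▹[ k ] w) j with does (j α.≟ k)
  ... | true  = ℕ.≤-refl
  ... | false = ℕ.m≤n⇒m≤1+n (coordinate-len p j)

  coordinate-len-≡ : ∀ p j → len p ≤ len (coordinate p j) → coordinate p j ≡ p
  coordinate-len-≡ (root w)     j _ = refl
  coordinate-len-≡ (p ▹[ k ] w) j 1+p≤ with does (j α.≟ k)
  ... | true  = refl
  ... | false = contradiction (ℕ.≤-trans 1+p≤ (coordinate-len p j)) (ℕ.<-irrefl refl)

  coordinate-valid : ∀ p j → Legal p → Legal (coordinate p j)
  coordinate-valid (root w)     j v = v
  coordinate-valid (p ▹[ k ] w) j v with does (j α.≟ k)
  ... | true  = v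
  ... | false = coordinate-valid p j (proj₁ v)

  Anchored : Pred α.Carrier ℓ → Path → Set ℓ
  Anchored J p = ∃ λ j → J j × coordinate p j ≡ p

  -- Each path equals a coordinate of the other and is thus a prefix of it. Comparing lengths shows
  -- that the prefix is not proper.
  coordinates-determine : ∀ {J p q} → Anchored J p → Anchored J q →
                          (∀ j → J j → coordinate p j ≡ coordinate q j) → p ≡ q
  coordinates-determine {p = p} {q} (j , Jj , pⱼ≡p) (k , Jk , qₖ≡q) agree =
    trans p≡qⱼ (coordinate-len-≡ q j (ℕ.≤-trans q≤p (ℕ.≤-reflexive (cong len p≡qⱼ))))
    where
    p≡qⱼ : p ≡ coordinate q j
    p≡qⱼ = trans (sym pⱼ≡p) (agree j Jj)
    q≡pₖ : q ≡ coordinate p k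
    q≡pₖ = trans (sym qₖ≡q) (sym (agree k Jk))
    q≤p : len q ≤ len p
    q≤p = ℕ.≤-trans (ℕ.≤-reflexive (cong len q≡pₖ)) (coordinate-len p k)

  anchored : α.Carrier → ∀ p → Anchored (λ _ → ⊤) p
  anchored i (root w)     = i , tt , refl
  anchored i (p ▹[ k ] w) = k , tt , coordinate-same p k w

  coordinate-injective : α.Carrier → ∀ {p q} → (∀ j → coordinate p j ≡ coordinate q j) → p ≡ q
  coordinate-injective i {p} {q} agree =
    coordinates-determine (anchored i p) (anchored i q) λ j _ → agree j

  -- The canonical representative of a class: legal paths are `i`-equivalent exactly if they strip
  -- to the same path.
  strip : α.Carrier → Path → Path
  strip i (root w)     = root w
  strip i (p ▹[ k ] w) = if does (k α.≟ i) then p else p ▹[ k ] w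

  strip-same : ∀ p i w → strip i (p ▹[ i ] w) ≡ p
  strip-same p i w rewrite dec-true (i α.≟ i) refl = refl

  strip-unlabelled : ∀ {i} → ¬ Label i → ∀ p → Legal p → strip i p ≡ p
  strip-unlabelled {i} ¬l (root w)     _ = refl
  strip-unlabelled {i} ¬l (p ▹[ k ] w) (_ , _ , _ , _ , l , _) with k α.≟ i
  ... | yes refl = contradiction l ¬l
  ... | no _     = refl

  strip-valid : ∀ i p → Legal p → Legal (strip i p)
  strip-valid i (root w)     v = v
  strip-valid i (p ▹[ k ] w) v with does (k α.≟ i)
  ... | true  = proj₁ v
  ... | false = v

  -- Reducedness enters here: beneath a removed step labelled `i` there is no second one.
  strip-notLast : ∀ i p → Legal p → NotLast i (strip i p)
  strip-notLast i (root w)     v = tt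
  strip-notLast i (p ▹[ k ] w) (_ , _ , _ , nl , _) with k α.≟ i
  ... | yes refl = nl
  ... | no k≢i   = k≢i

  strip-end : ∀ i p → Legal p → end (strip i p) ∼[ i ] end p
  strip-end i (root w)     v = ∼.refl
  strip-end i (p ▹[ k ] w) (_ , _ , r , _) with k α.≟ i
  ... | yes refl = r
  ... | no k≢i   = ∼.refl

  strip-len : ∀ i p → len (strip i p) ≤ len p
  strip-len i (root w)     = z≤n
  strip-len i (p ▹[ k ] w) with does (k α.≟ i)
  ... | true  = ℕ.n≤1+n (len p)
  ... | false = ℕ.≤-refl

  len-strip : ∀ i p → len p ≤ ℕ.suc (len (strip i p))
  len-strip i (root w)     = z≤n
  len-strip i (p ▹[ k ] w) with does (k α.≟ i)
  ... | true  = ℕ.≤-refl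
  ... | false = ℕ.n≤1+n _

  coordinate-strip : ∀ {i j} p → j ≢ i → coordinate (strip i p) j ≡ coordinate p j
  coordinate-strip (root w) j≢i = refl
  coordinate-strip {i} {j} (p ▹[ k ] w) j≢i with k α.≟ i
  ... | yes refl = sym (coordinate-other p w j≢i)
  ... | no _     = refl

  tree : Frame α.Carrier
  tree = coordinateFrame α (≡.setoid Path) Legal coordinate

  private module T = Frame tree

  module _ (2≤α : 2≤ α) where

    another : ∀ i → ∃ λ j → j ≢ i
    another i with proj₁ 2≤α α.≟ i
    ... | no k≢i   = _ , k≢i
    ... | yes refl = proj₁ (proj₂ 2≤α) , λ l≡k →
      IsStrictTotalOrder.irrefl α.isStrictTotalOrder (sym l≡k) (proj₂ (proj₂ 2≤α))

    -- A root needs an anchor other than `i`, which is where a second index is required. With one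
    -- index there would be no coordinate off `i`, and all paths would be equivalent.
    anchored-off : ∀ i p → NotLast i p → Anchored (_≢ i) p
    anchored-off i (root w)     _   = let j , j≢i = another i in j , j≢i , refl
    anchored-off i (p ▹[ k ] w) k≢i = k , k≢i , coordinate-same p k w

    ∼⇒strip≡ : ∀ {i p q} → Legal p → Legal q → p T.∼[ i ] q → strip i p ≡ strip i q
    ∼⇒strip≡ {i} {p} {q} vp vq p∼q = coordinates-determine
      (anchored-off i _ (strip-notLast i p vp))
      (anchored-off i _ (strip-notLast i q vq))
      λ j j≢i → trans (coordinate-strip p j≢i) (trans (p∼q j j≢i) (sym (coordinate-strip q j≢i)))

    -- Stripping `i` does nothing if `i` is not a label. Hence `c i` is the identity on a tree
    -- without that label, the source of local finiteness.
    ∼-unlabelled : ∀ {i p q} → ¬ Label i → Legal p → Legal q → p T.∼[ i ] q → p ≡ q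
    ∼-unlabelled ¬l vp vq p∼q =
      trans (sym (strip-unlabelled ¬l _ vp))
        (trans (∼⇒strip≡ vp vq p∼q) (strip-unlabelled ¬l _ vq))

    ∼⇒end∼ : ∀ {i p q} → Legal p → Legal q → p T.∼[ i ] q → end p ∼[ i ] end q
    ∼⇒end∼ {i} {p} {q} vp vq p∼q = ∼.trans (∼.sym (strip-end i p vp))
      (subst (λ r → end r ∼[ i ] end q) (sym (∼⇒strip≡ vp vq p∼q)) (strip-end i q vq))

    -- Both paths are their common stripped form plus at most one step. This bounds the depth that
    -- one cylindrification can use up.
    ∼⇒len≤ : ∀ {i p q} → Legal p → Legal q → p T.∼[ i ] q → len q ≤ ℕ.suc (len p)
    ∼⇒len≤ {i} {p} {q} vp vq p∼q = ℕ.≤-trans (len-strip i q)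
      (s≤s (subst (λ r → len r ≤ len p) (∼⇒strip≡ vp vq p∼q) (strip-len i p)))

  strip≡⇒∼ : ∀ {i} p q → strip i p ≡ strip i q → p T.∼[ i ] q
  strip≡⇒∼ {i} p q eq j j≢i = trans (sym (coordinate-strip p j≢i))
    (trans (cong (λ r → coordinate r j) eq) (coordinate-strip q j≢i))

  -- The new last step replaces a last step labelled i, if there is one.
  lift-∼ : (∀ {m n} → m ≤ n → Length n → Length m) → ∀ {i p w} → Legal p → Label i →
           Length (ℕ.suc (len p)) → Domain w → end p ∼[ i ] w →
           ∃ λ q → Legal q × p T.∼[ i ] q × end q ≡ w
  lift-∼ Length-↓ {i} {p} {w} vp l n d p∼w = strip i p ▹[ i ] w ,
    (strip-valid i p vp , d , ∼.trans (strip-end i p vp) p∼w , strip-notLast i p vp ,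
     l , Length-↓ (s≤s (strip-len i p)) n) ,
    strip≡⇒∼ p _ (sym (strip-same (strip i p) i w)) , refl

module Unravelling {ℓ} (em : ExcludedMiddle (suc ℓ)) (α : Ordinal ℓ) (2≤α : 2≤ α) where

  open Complex em
  open Representability em α
  private module α = Ordinal α

  module _ (F : Frame α.Carrier) (nonempty : ∃ (Frame.Domain F))
           (Label : Pred α.Carrier ℓ) (Length : Pred ℕ Level.zero) where

    open Tree α F Label Length

    module _ (Length-0 : Length 0) where

      tree-nonempty : ∃ Legal
      tree-nonempty = root (proj₁ nonempty) , proj₂ nonempty , Length-0

      tree-Drs : Drs α (Cm tree)
      tree-Drs = embedding⇒representation α
        (image-embedding (≡.setoid Path) Legal coordinate tree-nonempty
          λ _ _ → coordinate-injective (proj₁ 2≤α))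

  -- `end` is a bounded morphism from the tree to the frame: `∼⇒end∼` is the forth and `lift-∼` the
  -- back condition. The one-point paths make it surjective onto the domain, so taking preimages is
  -- injective.
  frame⇒Drs : ∀ {𝔄 F} → ∃ (Frame.Domain F) → Embedding 𝔄 (Cm F) → Drs α 𝔄
  frame⇒Drs {𝔄} {F} nonempty h = embedding⇒representation α
    (image-embedding (≡.setoid Path) Legal coordinate (tree-nonempty F nonempty _ _ _)
      (λ _ _ → coordinate-injective (proj₁ 2≤α)) ∘ᵉ unravel ∘ᵉ h)
    where
    open Tree α F (λ _ → ⊤) (λ _ → ⊤)
    unravel : Embedding (Cm F) (Cm tree)
    unravel = record
      { to             = λ X → X ∘ end
      ; isHomomorphism = record
        { cong   = λ X≈Y p vp → X≈Y (end p) (end-domain p vp)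
        ; ·-homo = λ _ _ _ _ → refl
        ; +-homo = λ _ _ _ _ → refl
        ; -‿homo = λ _ _ _ → refl
        ; 0-homo = λ _ _ → refl
        ; 1-homo = λ _ _ → refl
        ; c-homo = λ i X p vp → ⌊⌋-ext
            (λ (w , d , p∼w , x) →
              let q , vq , p∼q , q≡w = lift-∼ (λ _ _ → _) vp _ _ d p∼w
              in q , vq , p∼q , trans (cong X q≡w) x)
            (λ (q , vq , p∼q , x) →
              end q , end-domain q vq , ∼⇒end∼ 2≤α {p = p} {q} vp vq p∼q , x)
        }
      ; injective      = λ X≈Y w d → X≈Y (root w) (d , _)
      }

-- The equational axioms and their soundness.

module _ {ι} {I : Set ι} where

  private
    x y z : Term I
    x = var 0
    y = var 1
    z = var 2

  -- Lattice laws with one distributive law and the right complement laws, the form from which the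
  -- library's biased structures build a Boolean algebra.
  booleanAxioms : List (Equation I)
  booleanAxioms =
      (x +ᵗ y ≈ᵗ y +ᵗ x)
    ∷ ((x +ᵗ y) +ᵗ z ≈ᵗ x +ᵗ (y +ᵗ z))
    ∷ (x ·ᵗ y ≈ᵗ y ·ᵗ x)
    ∷ ((x ·ᵗ y) ·ᵗ z ≈ᵗ x ·ᵗ (y ·ᵗ z))
    ∷ (x +ᵗ (x ·ᵗ y) ≈ᵗ x)
    ∷ (x ·ᵗ (x +ᵗ y) ≈ᵗ x)
    ∷ ((y ·ᵗ z) +ᵗ x ≈ᵗ (y +ᵗ x) ·ᵗ (z +ᵗ x))
    ∷ (x +ᵗ (-ᵗ x) ≈ᵗ 1ᵗ)
    ∷ (x ·ᵗ (-ᵗ x) ≈ᵗ 0ᵗ)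
    ∷ []

  -- Halmos's axioms for an existential quantifier on a Boolean algebra, one index at a time;
  -- commutation of different cylindrifications is not among them.
  cylindrificationAxioms : I → List (Equation I)
  cylindrificationAxioms i =
      (cᵗ i 0ᵗ ≈ᵗ 0ᵗ)
    ∷ (x ·ᵗ cᵗ i x ≈ᵗ x)
    ∷ (cᵗ i (x ·ᵗ cᵗ i y) ≈ᵗ cᵗ i x ·ᵗ cᵗ i y)
    ∷ []

  axiomList : List I → List (Equation I)
  axiomList is = booleanAxioms ++ concatMap cylindrificationAxioms is

  record SatisfiesAxioms {a b} (𝔄 : Algebra I a b) : Set (ι ⊔ a ⊔ b) where
    field
      boolean         : All (𝔄 ⊨_) booleanAxioms
      cylindrification : ∀ i → All (𝔄 ⊨_) (cylindrificationAxioms i)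

  satisfiesAxioms-reflect : ∀ {a b a′ b′} {𝔄 : Algebra I a b} {𝔅 : Algebra I a′ b′} →
                            Embedding 𝔄 𝔅 → SatisfiesAxioms 𝔅 → SatisfiesAxioms 𝔄
  satisfiesAxioms-reflect h 𝔅⊨ = record
    { boolean          = All.map (λ {e} → embedding-reflects-⊨ h e) boolean
    ; cylindrification = λ i → All.map (λ {e} → embedding-reflects-⊨ h e) (cylindrification i)
    }
    where open SatisfiesAxioms 𝔅⊨

-- With at most one index metavariable per schema every assignment of indices is injective, so the
-- instances are exactly the axioms for the single indices.
axiomSchemas : List Schema
axiomSchemas = map (0 ,_) booleanAxioms ++ map (1 ,_) (cylindrificationAxioms zero)

module _ {ι a b} {I : Set ι} {𝔄 : Algebra I a b} where

  schemas⇒axioms : (∀ {e} → InstanceOf axiomSchemas e → 𝔄 ⊨ e) → SatisfiesAxioms 𝔄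
  schemas⇒axioms sat = record
    { boolean          = All.tabulate λ e∈ →
        let e′ , e′∈ , e≡ = ∈-map⁻ (rename λ ()) e∈ in
        sat ((0 , e′) , ∈-++⁺ˡ (∈-map⁺ (0 ,_) e′∈) , (λ ()) , (λ { {()} }) , e≡)
    ; cylindrification = λ i → All.tabulate λ e∈ →
        let e′ , e′∈ , e≡ = ∈-map⁻ (rename (const i)) e∈ in
        sat ((1 , e′) , ∈-++⁺ʳ (map (0 ,_) booleanAxioms) (∈-map⁺ (1 ,_) e′∈) ,
             const i , (λ { {zero} {zero} _ → refl }) , e≡)
    }

  axioms⇒schemas : SatisfiesAxioms 𝔄 → ∀ {e} → InstanceOf axiomSchemas e → 𝔄 ⊨ e
  axioms⇒schemas sat (σ , σ∈ , ρ , _ , refl)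
    with ∈-++⁻ (map (0 ,_) booleanAxioms) σ∈
  ... | inj₁ σ∈₀ with e′ , e′∈ , refl ← ∈-map⁻ (0 ,_) σ∈₀ =
    All.lookup (SatisfiesAxioms.boolean sat) (∈-map⁺ (rename ρ) e′∈)
  ... | inj₂ σ∈₁ with e′ , e′∈ , refl ← ∈-map⁻ (1 ,_) σ∈₁ =
    All.lookup (SatisfiesAxioms.cylindrification sat (ρ zero)) (∈-map⁺ (rename ρ) e′∈)

  module _ {is : List I} (all-is : ∀ i → i ∈ is) where

    list⇒axioms : (∀ {e} → e ∈ axiomList is → 𝔄 ⊨ e) → SatisfiesAxioms 𝔄
    list⇒axioms sat = record
      { boolean          = All.tabulate (sat ∘ ∈-++⁺ˡ)
      ; cylindrification = λ i → All.tabulate λ e∈ →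
          sat (∈-++⁺ʳ booleanAxioms (∈-concatMap⁺ cylindrificationAxioms (lose (all-is i) e∈)))
      }

    axioms⇒list : SatisfiesAxioms 𝔄 → ∀ {e} → e ∈ axiomList is → 𝔄 ⊨ e
    axioms⇒list sat e∈ with ∈-++⁻ booleanAxioms e∈
    ... | inj₁ e∈₀ = All.lookup (SatisfiesAxioms.boolean sat) e∈₀
    ... | inj₂ e∈₁ with i , _ , e∈′ ← find (∈-concatMap⁻ cylindrificationAxioms {xs = is} e∈₁) =
      All.lookup (SatisfiesAxioms.cylindrification sat i) e∈′

module _ {ℓ} (em : ExcludedMiddle (suc ℓ)) {I : Set ℓ} (F : Frame I) where

  open Complex em
  open Frame F

  Cm-satisfiesAxioms : SatisfiesAxioms (Cm F)
  Cm-satisfiesAxioms = record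
    { boolean          =
        (λ v w _ → Bool.∨-comm (v 0 w) (v 1 w))
      ∷ (λ v w _ → Bool.∨-assoc (v 0 w) (v 1 w) (v 2 w))
      ∷ (λ v w _ → Bool.∧-comm (v 0 w) (v 1 w))
      ∷ (λ v w _ → Bool.∧-assoc (v 0 w) (v 1 w) (v 2 w))
      ∷ (λ v w _ → Bool.∨-abs-∧ (v 0 w) (v 1 w))
      ∷ (λ v w _ → Bool.∧-abs-∨ (v 0 w) (v 1 w))
      ∷ (λ v w _ → Bool.∨-distribʳ-∧ (v 0 w) (v 1 w) (v 2 w))
      ∷ (λ v w _ → Bool.∨-inverseʳ (v 0 w))
      ∷ (λ v w _ → Bool.∧-inverseʳ (v 0 w))
      ∷ []
    ; cylindrification = λ i →
        (λ v w _ → dec-false em↓ λ { (_ , _ , _ , ()) })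
      ∷ (λ v w d → reflexive (v 0) i w d)
      ∷ (λ v w d → modular (v 0) (v 1) i w d)
      ∷ []
    }
    where
    reflexive : ∀ X i w → Domain w → X w ∧ ◇ F i X w ≡ X w
    reflexive X i w d with X w in eq
    ... | false = refl
    ... | true  = ⌊⌋⁺ (w , d , ∼.refl , eq)

    -- Transitivity gives one inclusion. The other passes from `v` to `u` through `w` and needs
    -- symmetry as well.
    modular : ∀ X Y i w → Domain w →
              ◇ F i (λ v → X v ∧ ◇ F i Y v) w ≡ ◇ F i X w ∧ ◇ F i Y w
    modular X Y i w d = does-⇔ (mk⇔
      (λ (v , dv , w∼v , xy) →
        let x , y = ∧-true⁻ xy
            u , du , v∼u , y′ = ◇⁻ F {i} {Y} {v} y
        in (v , dv , w∼v , x) , (u , du , ∼.trans w∼v v∼u , y′))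
      (λ ((v , dv , w∼v , x) , (u , du , w∼u , y)) →
        v , dv , w∼v , cong₂ _∧_ x (⌊⌋⁺ (u , du , ∼.trans (∼.sym w∼v) w∼u , y))))
      em↓ (em↓ ×-dec em↓)

-- Consequences of the axioms.

module Laws {ι a b} {I : Set ι} {𝔄 : Algebra I a b} (sat : SatisfiesAxioms 𝔄) where

  open Algebra 𝔄
  open SatisfiesAxioms sat

  private
    assign : Carrier → Carrier → Carrier → ℕ → Carrier
    assign x y z 0 = x
    assign x y z 1 = y
    assign x y z _ = z

    isBooleanAlgebra : All (𝔄 ⊨_) booleanAxioms → IsBooleanAlgebra _≈_ _+_ _·_ -_ 1# 0#
    isBooleanAlgebra
      (+-comm ∷ +-assoc ∷ ·-comm ∷ ·-assoc ∷ +-abs ∷ ·-abs ∷ distrib ∷ +-inv ∷ ·-inv ∷ []) =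
      isBooleanAlgebraʳ record
        { isDistributiveLattice = isDistributiveLatticeʳʲᵐ record
          { isLattice    = record
            { isEquivalence = isEquivalence
            ; ∨-comm        = λ x y → +-comm (assign x y y)
            ; ∨-assoc       = λ x y z → +-assoc (assign x y z)
            ; ∨-cong        = +-cong
            ; ∧-comm        = λ x y → ·-comm (assign x y y)
            ; ∧-assoc       = λ x y z → ·-assoc (assign x y z)
            ; ∧-cong        = ·-cong
            ; absorptive    = (λ x y → +-abs (assign x y y)) , (λ x y → ·-abs (assign x y y))
            }
          ; ∨-distribʳ-∧ = λ x y z → distrib (assign x y z)
          }
        ; ∨-complementʳ         = λ x → +-inv (assign x x x)
        ; ∧-complementʳ         = λ x → ·-inv (assign x x x)
        ; ¬-cong                = -‿cong
        }

  booleanAlgebra : BooleanAlgebra a b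
  booleanAlgebra = record { isBooleanAlgebra = isBooleanAlgebra boolean }

  open BooleanAlgebra booleanAlgebra public
    using (setoid; ∧-comm; ∧-assoc; ∧-complementʳ; ∨-complementʳ; ∧-distribˡ-∨; ∧-absorbs-∨; ∨-comm; ∨-distribʳ-∧)
  open BooleanAlgebraProperties booleanAlgebra public
    using (∧-identityʳ; ∧-identityˡ; ∨-identityʳ; ∧-zeroʳ; ∧-idem; deMorgan₂; ¬-involutive)

  module ≈ = IsEquivalence isEquivalence
  open SetoidReasoning setoid

  c-0 : ∀ i → c i 0# ≈ 0#
  c-0 i with cylindrification i
  ... | law ∷ _ = law (const 0#)

  x≤cx : ∀ i x → x ≤ c i x
  x≤cx i x with cylindrification i
  ... | _ ∷ law ∷ _ = law (const x)

  c-modular : ∀ i x y → c i (x · c i y) ≈ c i x · c i y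
  c-modular i x y with cylindrification i
  ... | _ ∷ _ ∷ law ∷ [] = law (assign x y y)

  ≤-antisym : ∀ {x y} → x ≤ y → y ≤ x → x ≈ y
  ≤-antisym x≤y y≤x = ≈.trans (≈.sym x≤y) (≈.trans (∧-comm _ _) y≤x)

  ≤-trans : ∀ {x y z} → x ≤ y → y ≤ z → x ≤ z
  ≤-trans {x} {y} {z} x≤y y≤z = begin
    x · z       ≈⟨ ·-cong x≤y ≈.refl ⟨
    x · y · z   ≈⟨ ∧-assoc x y z ⟩
    x · (y · z) ≈⟨ ·-cong ≈.refl y≤z ⟩
    x · y       ≈⟨ x≤y ⟩
    x           ∎

  x·y≤y : ∀ x y → x · y ≤ y
  x·y≤y x y = ≈.trans (∧-assoc x y y) (·-cong ≈.refl (∧-idem y))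

  x·y≤x : ∀ x y → x · y ≤ x
  x·y≤x x y = ≈.trans (·-cong (∧-comm x y) ≈.refl) (≈.trans (x·y≤y y x) (∧-comm y x))

  ≤-glb : ∀ {x y z} → z ≤ x → z ≤ y → z ≤ x · y
  ≤-glb {x} {y} {z} z≤x z≤y = ≈.trans (≈.sym (∧-assoc z x y)) (≈.trans (·-cong z≤x ≈.refl) z≤y)

  ≈⇒≤ : ∀ {x y} → x ≈ y → x ≤ y
  ≈⇒≤ {x} x≈y = ≈.trans (·-cong ≈.refl (≈.sym x≈y)) (∧-idem x)

  x≤1 : ∀ x → x ≤ 1#
  x≤1 = ∧-identityʳ

  x≤x+y : ∀ x y → x ≤ x + y
  x≤x+y = ∧-absorbs-∨

  x·-y≈0⇒x≤y : ∀ {x y} → x · - y ≈ 0# → x ≤ y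
  x·-y≈0⇒x≤y {x} {y} x-y≈0 = begin
    x · y           ≈⟨ ∨-identityʳ (x · y) ⟨
    x · y + 0#      ≈⟨ +-cong ≈.refl x-y≈0 ⟨
    x · y + x · - y ≈⟨ ∧-distribˡ-∨ x y (- y) ⟨
    x · (y + - y)   ≈⟨ ·-cong ≈.refl (∨-complementʳ y) ⟩
    x · 1#          ≈⟨ ∧-identityʳ x ⟩
    x               ∎

  x·y≈0⇒x≤-y : ∀ {x y} → x · y ≈ 0# → x ≤ - y
  x·y≈0⇒x≤-y {x} {y} xy≈0 =
    x·-y≈0⇒x≤y (≈.trans (·-cong ≈.refl (¬-involutive y)) xy≈0)

  c-1 : ∀ i → c i 1# ≈ 1#
  c-1 i = ≈.trans (≈.sym (∧-identityˡ (c i 1#))) (x≤cx i 1#)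

  c-idem : ∀ i x → c i (c i x) ≈ c i x
  c-idem i x = begin
    c i (c i x)      ≈⟨ c-cong i (∧-identityˡ (c i x)) ⟨
    c i (1# · c i x) ≈⟨ c-modular i 1# x ⟩
    c i 1# · c i x   ≈⟨ ·-cong (c-1 i) ≈.refl ⟩
    1# · c i x       ≈⟨ ∧-identityˡ (c i x) ⟩
    c i x            ∎

  c-modular-closed : ∀ i x {y} → c i y ≈ y → c i (x · y) ≈ c i x · y
  c-modular-closed i x {y} cy≈y = begin
    c i (x · y)     ≈⟨ c-cong i (·-cong ≈.refl cy≈y) ⟨
    c i (x · c i y) ≈⟨ c-modular i x y ⟩
    c i x · c i y   ≈⟨ ·-cong ≈.refl cy≈y ⟩
    c i x · y       ∎

  c-·-closed : ∀ i {x y} → c i x ≈ x → c i y ≈ y → c i (x · y) ≈ x · y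
  c-·-closed i cx≈x cy≈y = ≈.trans (c-modular-closed i _ cy≈y) (·-cong cx≈x ≈.refl)

  -- The modular law moves the closed `x` under the cylindrification, where it meets `- x` in `0#`.
  -- Complements of closed elements are what lets `canonical-back` obtain agreement in both
  -- directions.
  c-‿closed : ∀ i {x} → c i x ≈ x → c i (- x) ≈ - x
  c-‿closed i {x} cx≈x = ≤-antisym (x·y≈0⇒x≤-y (begin
    c i (- x) · x ≈⟨ c-modular-closed i (- x) cx≈x ⟨
    c i (- x · x) ≈⟨ c-cong i (≈.trans (∧-comm (- x) x) (∧-complementʳ x)) ⟩
    c i 0#        ≈⟨ c-0 i ⟩
    0#            ∎)) (x≤cx i (- x))

  -- Read contrapositively, this is the consistency of the filter built in `canonical-back`.
  x·y≈0⇒cx·y≈0 : ∀ i {x y} → c i y ≈ y → x · y ≈ 0# → c i x · y ≈ 0#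
  x·y≈0⇒cx·y≈0 i {x} {y} cy≈y xy≈0 = begin
    c i x · y   ≈⟨ c-modular-closed i x cy≈y ⟨
    c i (x · y) ≈⟨ c-cong i xy≈0 ⟩
    c i 0#      ≈⟨ c-0 i ⟩
    0#          ∎

-- Ultrafilters and the ultrafilter frame.

record IsUltrafilter {ι a b} {I : Set ι} (𝔄 : Algebra I a b)
                     (u : Algebra.Carrier 𝔄 → Bool) : Set (a ⊔ b) where
  open Algebra 𝔄
  field
    u-cong : ∀ {x y} → x ≈ y → u x ≡ u y
    u-·    : ∀ x y → u (x · y) ≡ u x ∧ u y
    u-+    : ∀ x y → u (x + y) ≡ u x ∨ u y
    u--    : ∀ x → u (- x) ≡ not (u x)
    u-0    : u 0# ≡ false
    u-1    : u 1# ≡ true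

  u-≤ : ∀ {x y} → x ≤ y → u x ≡ true → u y ≡ true
  u-≤ {x} {y} x≤y ux =
    proj₂ (∧-true⁻ {u x} (trans (sym (u-· x y)) (trans (u-cong x≤y) ux)))

  u-≉0 : ∀ {x} → u x ≡ true → ¬ (x ≈ 0#)
  u-≉0 ux x≈0 with () ← trans (sym ux) (trans (u-cong x≈0) u-0)

  u-·⁺ : ∀ {x y} → u x ≡ true → u y ≡ true → u (x · y) ≡ true
  u-·⁺ {x} {y} ux uy = trans (u-· x y) (cong₂ _∧_ ux uy)

  u--⁺ : ∀ {x} → u x ≡ false → u (- x) ≡ true
  u--⁺ {x} ux = trans (u-- x) (cong not ux)

  u--⁻ : ∀ {x} → u (- x) ≡ true → u x ≡ false
  u--⁻ {x} u-x = trans (sym (Bool.not-involutive (u x))) (cong not (trans (sym (u-- x)) u-x))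

module Ultrafilters {ℓ} (classical : Classical ℓ) {I : Set ℓ} {𝔄 : Algebra I ℓ ℓ}
                    (sat : SatisfiesAxioms 𝔄) where

  open Classical classical
  open Complex excludedMiddle
  open Algebra 𝔄
  open Laws sat

  private
    Sub : Set ℓ
    Sub = Carrier → Bool

    infix 4 _⊑_
    _⊑_ : Sub → Sub → Set ℓ
    X ⊑ Y = ∀ {x} → X x ≡ true → Y x ≡ true

    ∅ : Sub
    ∅ _ = false

    infixl 6 _∪_
    _∪_ : Sub → Carrier → Sub
    (X ∪ b) x = X x ∨ ⌊ x ≡ b ⌋

    ⋃ : {J : Set ℓ} → (J → Sub) → Sub
    ⋃ F x = ⌊ ∃ (λ j → F j x ≡ true) ⌋

  -- By the Bourbaki–Witt argument, the sets obtained from ∅ by taking unions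
  -- and adding a chosen element that keeps the generated filter proper form a
  -- chain; its largest element generates an ultrafilter.
  module _ (G : Pred Carrier ℓ) (1∈G : G 1#) where

    private
      data Generated (X : Sub) : Pred Carrier ℓ where
        base : ∀ {x} → G x → Generated X x
        mem  : ∀ {x} → X x ≡ true → Generated X x
        meet : ∀ {x y} → Generated X x → Generated X y → Generated X (x · y)
        up   : ∀ {x y} → x ≤ y → Generated X x → Generated X y

      generated-mono : ∀ {X Y} → X ⊑ Y → Generated X ⊆ Generated Y
      generated-mono X⊑Y (base g)   = base g
      generated-mono X⊑Y (mem x)    = mem (X⊑Y x)
      generated-mono X⊑Y (meet p q) = meet (generated-mono X⊑Y p) (generated-mono X⊑Y q)
      generated-mono X⊑Y (up le p)  = up le (generated-mono X⊑Y p)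

      Consistent : Pred Sub ℓ
      Consistent X = ¬ Generated X 0#

      consistent-anti : ∀ {X Y} → X ⊑ Y → Consistent Y → Consistent X
      consistent-anti X⊑Y ¬Y0 X0 = ¬Y0 (generated-mono X⊑Y X0)

      Extends : Sub → Carrier → Set ℓ
      Extends X b = X b ≡ false × Consistent (X ∪ b)

      ∪-mono : ∀ {X Y} b → X ⊑ Y → X ∪ b ⊑ Y ∪ b
      ∪-mono {X} {Y} b X⊑Y {x} Xb with ∨-true⁻ Xb
      ... | inj₁ Xx  = ∨-true⁺ˡ (X⊑Y Xx)
      ... | inj₂ x≡b = ∨-true⁺ʳ (Y x) x≡b

      extends-resp : ∀ {X Y} → (∀ x → X x ≡ Y x) → ∀ {b} → Extends X b → Extends Y b
      extends-resp X≡Y {b} (b∉X , con) = trans (sym (X≡Y b)) b∉X ,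
        consistent-anti (∪-mono b (λ {x} Yx → trans (X≡Y x) Yx)) con

      -- Pointwise equality makes the chosen element depend on the set alone. The lifts only meet
      -- the level at which `choice` is available.
      subs : Setoid (suc ℓ) (suc ℓ)
      subs = record
        { Carrier       = Lift (suc ℓ) Sub
        ; _≈_           = λ X Y → Lift (suc ℓ) (∀ x → lower X x ≡ lower Y x)
        ; isEquivalence = record
          { refl  = lift λ _ → refl
          ; sym   = λ p → lift λ x → sym (lower p x)
          ; trans = λ p q → lift λ x → trans (lower p x) (lower q x)
          }
        }

      -- The relation is an implication so as to be total, as `choice` demands.
      chosen : Σ[ f ∈ Func subs (≡.setoid (Lift (suc ℓ) Carrier)) ]
               (∀ X → Lift (suc ℓ) (∃ (Extends (lower X)) → Extends (lower X) (lower (Func.to f X))))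
      chosen = choice subs (≡.setoid (Lift (suc ℓ) Carrier))
        (λ X b → Lift (suc ℓ) (∃ (Extends (lower X)) → Extends (lower X) (lower b)))
        (λ { X≡Y refl r → lift λ (b , e) → extends-resp (lower X≡Y)
             (lower r (b , extends-resp (λ x → sym (lower X≡Y x)) e)) })
        some
        where
        some : ∀ X → ∃ λ b → Lift (suc ℓ) (∃ (Extends (lower X)) → Extends (lower X) (lower b))
        some X with em↓ {∃ (Extends (lower X))}
        ... | yes (b , e) = lift b , lift λ _ → e
        -- Nothing extends `X`, so the implication is vacuous and `0#` is an arbitrary default.
        ... | no ¬e       = lift 0# , lift λ e → contradiction e ¬e

      ch : Sub → Carrier
      ch X = lower (Func.to (proj₁ chosen) (lift X))

      ch-resp : ∀ {X Y} → (∀ x → X x ≡ Y x) → ch X ≡ ch Y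
      ch-resp X≡Y = cong lower (Func.cong (proj₁ chosen) (lift X≡Y))

      ch-extends : ∀ {X b} → Extends X b → Extends X (ch X)
      ch-extends {X} {b} e = lower (proj₂ chosen (lift X)) (b , e)

      next : Sub → Sub
      next X x = X x ∨ ⌊ Extends X x × x ≡ ch X ⌋

      next⁻ : ∀ {X x} → next X x ≡ true → X x ≡ true ⊎ Extends X x × x ≡ ch X
      next⁻ = Sum.map₂ ⌊⌋⁻ ∘ ∨-true⁻

      next-new : ∀ {X x} → Extends X x → x ≡ ch X → next X x ≡ true
      next-new {X} {x} e x≡ch = ∨-true⁺ʳ (X x) (⌊⌋⁺ (e , x≡ch))

      ⊑-next : ∀ {X} → X ⊑ next X
      ⊑-next Xx = ∨-true⁺ˡ Xx

      next-cong : ∀ {X Y} → X ⊑ Y → Y ⊑ X → next X ⊑ next Y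
      next-cong {X} {Y} X⊑Y Y⊑X {x} nx with next⁻ nx
      ... | inj₁ Xx         = ∨-true⁺ˡ (X⊑Y Xx)
      ... | inj₂ (e , x≡ch) = next-new (extends-resp X≡Y e) (trans x≡ch (ch-resp X≡Y))
        where
        X≡Y : ∀ x → X x ≡ Y x
        X≡Y x = Bool.⇔→≡ (mk⇔ X⊑Y Y⊑X)

      -- `next X` has at most one element more than `X`, so nothing fits strictly between them.
      next-step : ∀ {X Y} → X ⊑ Y → Y ⊑ next X → Y ⊑ X ⊎ next X ⊑ Y
      next-step {X} {Y} X⊑Y Y⊑nX with em↓ {∃ λ y → Y y ≡ true × X y ≡ false}
      ... | no ¬∃ = inj₁ λ {y} Yy → Bool.¬-not λ Xy → ¬∃ (y , Yy , Xy)
      ... | yes (y , Yy , y∉X) with next⁻ (Y⊑nX Yy)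
      ...   | inj₁ Xy with () ← trans (sym Xy) y∉X
      ...   | inj₂ (e , y≡ch) = inj₂ λ nx →
        [ X⊑Y , (λ (_ , x≡ch) → subst (λ z → Y z ≡ true) (trans y≡ch (sym x≡ch)) Yy) ]′ (next⁻ nx)

      -- Transfinite iteration of `next` without ordinals. The union of the empty family is the
      -- starting point `∅`.
      data Tower : Pred Sub (suc ℓ) where
        step  : ∀ {X} → Tower X → Tower (next X)
        union : {J : Set ℓ} (F : J → Sub) → (∀ j → Tower (F j)) → Tower (⋃ F)

      Comparable : Sub → Set (suc ℓ)
      Comparable Y = ∀ {X} → Tower X → X ⊑ Y ⊎ Y ⊑ X

      -- Induction on the tower of `X`. At a successor, comparability with `next X` and `next-step`
      -- leave as critical case that `X` and `Y` coincide, and then so do `next X` and `next Y`.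
      below-or-above : ∀ {X Y} → Comparable Y → Tower X → X ⊑ Y ⊎ next Y ⊑ X
      below-or-above {Y = Y} cmp (step {X} TX) with below-or-above cmp TX
      ... | inj₂ nY⊑X = inj₂ λ nx → ⊑-next {X} (nY⊑X nx)
      ... | inj₁ X⊑Y with cmp (step TX)
      ...   | inj₁ nX⊑Y = inj₁ nX⊑Y
      ...   | inj₂ Y⊑nX with next-step {X} {Y} X⊑Y Y⊑nX
      ...     | inj₁ Y⊑X  = inj₂ (next-cong {Y} {X} Y⊑X X⊑Y)
      ...     | inj₂ nX⊑Y = inj₁ nX⊑Y
      below-or-above {Y = Y} cmp (union F TF) with em↓ {∃ λ j → ¬ (F j ⊑ Y)}
      ... | no ¬∃       = inj₁ λ Fx → let j , Fjx = ⌊⌋⁻ Fx in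
        decidable-stable em↓ (λ Fj⋢Y → ¬∃ (j , Fj⋢Y)) Fjx
      ... | yes (j , Fj⋢Y) with below-or-above cmp (TF j)
      ...   | inj₁ Fj⊑Y  = ⊥-elim (Fj⋢Y Fj⊑Y)
      ...   | inj₂ nY⊑Fj = inj₂ λ nx → ⌊⌋⁺ (j , nY⊑Fj nx)

      comparable : ∀ {Y} → Tower Y → Comparable Y
      comparable (step {Y} TY) {X} TX with below-or-above (comparable TY) TX
      ... | inj₁ X⊑Y  = inj₁ λ Xx → ⊑-next {Y} (X⊑Y Xx)
      ... | inj₂ nY⊑X = inj₂ nY⊑X
      comparable (union F TF) {X} TX with em↓ {∃ λ j → X ⊑ F j}
      ... | yes (j , X⊑Fj) = inj₁ λ Xx → ⌊⌋⁺ (j , X⊑Fj Xx)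
      ... | no ¬∃          = inj₂ λ Fx → let j , Fjx = ⌊⌋⁻ Fx in
        [ (λ X⊑Fj → ⊥-elim (¬∃ (j , λ {x} → X⊑Fj {x}))) , (λ Fj⊑X → Fj⊑X Fjx) ]′ (comparable (TF j) TX)

      -- A derivation uses finitely many members, and in a chain these lie in a single `F j`. The
      -- alternative `∅` covers derivations without members, since `J` may be empty.
      generated-⋃ : ∀ {J} (F : J → Sub) → (∀ j → Tower (F j)) → ∀ {x} → Generated (⋃ F) x →
                    Generated ∅ x ⊎ ∃ λ j → Generated (F j) x
      generated-⋃ F TF (base g) = inj₁ (base g)
      generated-⋃ F TF (mem Fx) = let j , Fjx = ⌊⌋⁻ Fx in inj₂ (j , mem Fjx)
      generated-⋃ F TF (up le p) = Sum.map (up le) (λ (j , q) → j , up le q) (generated-⋃ F TF p)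
      generated-⋃ F TF (meet p q) with generated-⋃ F TF p | generated-⋃ F TF q
      ... | inj₁ p′       | inj₁ q′       = inj₁ (meet p′ q′)
      ... | inj₁ p′       | inj₂ (j , q′) = inj₂ (j , meet (generated-mono (λ ()) p′) q′)
      ... | inj₂ (j , p′) | inj₁ q′       = inj₂ (j , meet p′ (generated-mono (λ ()) q′))
      ... | inj₂ (j , p′) | inj₂ (k , q′) with comparable (TF k) (TF j)
      ...   | inj₁ Fj⊑Fk = inj₂ (k , meet (generated-mono Fj⊑Fk p′) q′)
      ...   | inj₂ Fk⊑Fj = inj₂ (j , meet p′ (generated-mono Fk⊑Fj q′))

      tower-consistent : Consistent ∅ → ∀ {X} → Tower X → Consistent X
      tower-consistent con (step {X} TX) with em↓ {Extends X (ch X)}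
      ... | yes (_ , con′) = consistent-anti (λ {x} nx →
        [ (λ Xx → ∨-true⁺ˡ Xx)
        , (λ (_ , x≡ch) → ∨-true⁺ʳ (X x) (⌊⌋⁺ x≡ch))
        ]′ (next⁻ nx)) con′
      ... | no ¬e          = consistent-anti (λ nx →
        [ id , (λ { (e , refl) → contradiction e ¬e }) ]′ (next⁻ nx)) (tower-consistent con TX)
      tower-consistent con (union F TF) F0 with generated-⋃ F TF F0
      ... | inj₁ p       = con p
      ... | inj₂ (j , p) = tower-consistent con (TF j) p

      -- Excluded middle turns the large predicate `Tower` into a small one. The whole tower can
      -- then index a union, so its largest element `M` belongs to it.
      InTower : Sub → Set
      InTower X = does (excludedMiddle {Tower X}) ≡ true

      M : Sub
      M = ⋃ {∃ InTower} proj₁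

      M-tower : Tower M
      M-tower = union proj₁ λ (_ , t) → does-true⁻ excludedMiddle t

      -- `next M` is in the tower and hence included in `M`, but if anything extended `M`, then
      -- `next M` would contain the new element `ch M`.
      M-maximal : ∀ b → ¬ Extends M b
      M-maximal b e = contradiction (trans (sym M-ch) (proj₁ (ch-extends e))) λ ()
        where
        M-ch : M (ch M) ≡ true
        M-ch = ⌊⌋⁺ ((next M , dec-true excludedMiddle (step M-tower)) ,
                    next-new (ch-extends e) refl)

      generated-1 : ∀ {X} → Generated X 1#
      generated-1 = base 1∈G

      -- The deduction theorem, with `x + - b` as the implication from `b` to `x`.
      deduction : ∀ {X b x} → Generated (X ∪ b) x → Generated X (x + - b)
      deduction (base g) = up (x≤x+y _ _) (base g)
      deduction {X} (mem {x} Xx) with ∨-true⁻ {X x} Xx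
      ... | inj₁ Xx′ = up (x≤x+y _ _) (mem Xx′)
      ... | inj₂ x≡b with refl ← ⌊⌋⁻ {x ≡ _} x≡b = up (≈⇒≤ (≈.sym (∨-complementʳ _))) generated-1
      deduction {b = b} (meet {x} {y} p q) =
        up (≈⇒≤ (≈.sym (∨-distribʳ-∧ (- b) x y))) (meet (deduction p) (deduction q))
      deduction {b = b} (up {x} {y} x≤y p) =
        up (≈.trans (≈.sym (∨-distribʳ-∧ (- b) x y)) (+-cong x≤y ≈.refl)) (deduction p)

      M-decides : ∀ b → Generated M b ⊎ Generated M (- b)
      M-decides b with M b in eq
      ... | true  = inj₁ (mem eq)
      -- By maximality adding `b` generates `0#`, so `M` already generates `0# + - b`.
      ... | false = inj₂ (up (≈⇒≤ (≈.trans (∨-comm 0# (- b)) (∨-identityʳ (- b))))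
        (deduction (decidable-stable em↓ λ con → M-maximal b (eq , con))))

      consistent : (∀ {x y} → G x → G y → G (x · y)) → (∀ {x} → G x → ¬ (x ≈ 0#)) → Consistent ∅
      consistent ·-closed G≉0 p0 = let g , Gg , g≤0 = go p0 in
        G≉0 Gg (≈.trans (≈.sym g≤0) (∧-zeroʳ g))
        where
        go : ∀ {x} → Generated ∅ x → ∃ λ g → G g × g ≤ x
        go (base {x} g) = x , g , ≈⇒≤ ≈.refl
        go (up le p)    = let g , Gg , g≤ = go p in g , Gg , ≤-trans g≤ le
        go (meet p q)   =
          let g , Gg , g≤ = go p
              h , Gh , h≤ = go q
          in g · h , ·-closed Gg Gh , ≤-glb (≤-trans (x·y≤x g h) g≤) (≤-trans (x·y≤y g h) h≤)

    module _ (·-closed : ∀ {x y} → G x → G y → G (x · y))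
             (G≉0 : ∀ {x} → G x → ¬ (x ≈ 0#)) where

      private
        M-consistent : Consistent M
        M-consistent = tower-consistent (consistent ·-closed G≉0) M-tower

        not-both : ∀ {x} → Generated M x → ¬ Generated M (- x)
        not-both {x} p q = M-consistent (up (≈⇒≤ (∧-complementʳ x)) (meet p q))

        u : Sub
        u x = ⌊ Generated M x ⌋

        cong-u : ∀ {x y} → x ≈ y → u x ≡ u y
        cong-u x≈y = ⌊⌋-ext (up (≈⇒≤ x≈y)) (up (≈⇒≤ (≈.sym x≈y)))

        homo-· : ∀ x y → u (x · y) ≡ u x ∧ u y
        homo-· x y = does-⇔ (mk⇔
          (λ p → up (x·y≤x x y) p , up (x·y≤y x y) p) (λ (p , q) → meet p q)) em↓ (em↓ ×-dec em↓)

        homo-- : ∀ x → u (- x) ≡ not (u x)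
        homo-- x = does-⇔ (mk⇔ (flip not-both)
          (λ ¬p → [ (λ p → contradiction p ¬p) , id ]′ (M-decides x))) em↓ (¬? em↓)

        homo-1 : u 1# ≡ true
        homo-1 = ⌊⌋⁺ generated-1

        not-∧-not : ∀ x y → not (not x ∧ not y) ≡ x ∨ y
        not-∧-not true  y = refl
        not-∧-not false y = Bool.not-involutive y

        homo-+ : ∀ x y → u (x + y) ≡ u x ∨ u y
        homo-+ x y = begin
          u (x + y)                   ≡⟨ cong-u (¬-involutive (x + y)) ⟨
          u (- - (x + y))             ≡⟨ cong-u (-‿cong (deMorgan₂ x y)) ⟩
          u (- (- x · - y))           ≡⟨ homo-- (- x · - y) ⟩
          not (u (- x · - y))         ≡⟨ cong not (homo-· (- x) (- y)) ⟩
          not (u (- x) ∧ u (- y))     ≡⟨ cong not (cong₂ _∧_ (homo-- x) (homo-- y)) ⟩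
          not (not (u x) ∧ not (u y)) ≡⟨ not-∧-not (u x) (u y) ⟩
          u x ∨ u y                   ∎
          where open ≡-Reasoning

      ultrafilter : ∃ λ u → IsUltrafilter 𝔄 u × (∀ {x} → G x → u x ≡ true)
      ultrafilter = u , record
        { u-cong = cong-u
        ; u-·    = homo-·
        ; u-+    = homo-+
        ; u--    = homo--
        ; u-0    = dec-false em↓ M-consistent
        ; u-1    = homo-1
        } , ⌊⌋⁺ ∘ base

module _ {ι a b} {I : Set ι} {𝔄 : Algebra I a b} where

  private module A = Algebra 𝔄

  MeetClosed : ∀ {p} → Pred A.Carrier p → Set (a ⊔ p)
  MeetClosed G = ∀ {x y} → G x → G y → G (x A.· y)

  ultrafilter-⊆⇒≡ : ∀ {u v} → IsUltrafilter 𝔄 u → IsUltrafilter 𝔄 v →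
                    (∀ {x} → u x ≡ true → v x ≡ true) → ∀ x → u x ≡ v x
  ultrafilter-⊆⇒≡ {u} {v} uU vU u⊆v x with u x in eq
  ... | true  = sym (u⊆v eq)
  ... | false = sym (V.u--⁻ (u⊆v (W.u--⁺ eq)))
    where
    module W = IsUltrafilter uU
    module V = IsUltrafilter vU

module CanonicalFrame {ℓ} (classical : Classical ℓ) {I : Set ℓ} {𝔄 : Algebra I ℓ ℓ}
                      (sat : SatisfiesAxioms 𝔄) where

  open Complex (Classical.excludedMiddle classical)
  open Ultrafilters classical sat
  open Algebra 𝔄
  open Laws sat
  open IsUltrafilter

  IsUF : (Carrier → Bool) → Set ℓ
  IsUF = IsUltrafilter 𝔄

  Singleton : Carrier → Pred Carrier ℓ
  Singleton x y = y ≈ x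

  singleton-closed : ∀ x → MeetClosed {𝔄 = 𝔄} (Singleton x)
  singleton-closed x y≈x z≈x = ≈.trans (·-cong y≈x z≈x) (∧-idem x)

  ·-interchange : ∀ w x y z → (w · x) · (y · z) ≈ (w · y) · (x · z)
  ·-interchange w x y z = begin
    (w · x) · (y · z) ≈⟨ ∧-assoc w x (y · z) ⟩
    w · (x · (y · z)) ≈⟨ ·-cong ≈.refl (∧-assoc x y z) ⟨
    w · (x · y · z)   ≈⟨ ·-cong ≈.refl (·-cong (∧-comm x y) ≈.refl) ⟩
    w · (y · x · z)   ≈⟨ ·-cong ≈.refl (∧-assoc y x z) ⟩
    w · (y · (x · z)) ≈⟨ ∧-assoc w y (x · z) ⟨
    (w · y) · (x · z) ∎
    where open SetoidReasoning setoid

  -- The meets of one element from each set are nonzero and closed under meets, hence generate a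
  -- proper filter. All later ultrafilters are built from two meet-closed sets in this way.
  ultrafilter-extending : ∀ {G H : Pred Carrier ℓ} → ∃ G → ∃ H →
    MeetClosed {𝔄 = 𝔄} G → MeetClosed {𝔄 = 𝔄} H →
    (∀ {g h} → G g → H h → ¬ (g · h ≈ 0#)) →
    ∃ λ u → IsUF u × (∀ {g} → G g → u g ≡ true) × (∀ {h} → H h → u h ≡ true)
  ultrafilter-extending {G} {H} (g₀ , Gg₀) (h₀ , Hh₀) G-closed H-closed G·H≉0 =
    let u , uU , K⊆u = ultrafilter K (g₀ , h₀ , Gg₀ , Hh₀ , x≤1 _)
          (λ {x} {y} (g , h , Gg , Hh , gh≤x) (g′ , h′ , Gg′ , Hh′ , gh′≤y) →
            g · g′ , h · h′ , G-closed Gg Gg′ , H-closed Hh Hh′ ,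
            ≤-trans (≈⇒≤ (·-interchange g g′ h h′))
              (≤-glb (≤-trans (x·y≤x _ _) gh≤x) (≤-trans (x·y≤y _ _) gh′≤y)))
          (λ (g , h , Gg , Hh , gh≤x) x≈0 →
            G·H≉0 Gg Hh (≈.trans (≈.sym gh≤x) (≈.trans (·-cong ≈.refl x≈0) (∧-zeroʳ _))))
    in u , uU , (λ Gg → K⊆u (_ , h₀ , Gg , Hh₀ , x·y≤x _ _)) ,
                (λ Hh → K⊆u (g₀ , _ , Gg₀ , Hh , x·y≤y _ _))
    where
    K : Pred Carrier ℓ
    K x = ∃₂ λ g h → G g × H h × g · h ≤ x

  ultrafilter-containing : ∀ {x} → ¬ (x ≈ 0#) → ∃ λ u → IsUF u × u x ≡ true
  ultrafilter-containing {x} x≉0 =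
    let u , uU , x∈u , _ = ultrafilter-extending (x , ≈.refl) (x , ≈.refl)
          (singleton-closed x) (singleton-closed x)
          (λ g≈x h≈x gh≈0 → x≉0
            (≈.trans (≈.sym (∧-idem x)) (≈.trans (≈.sym (·-cong g≈x h≈x)) gh≈0)))
    in u , uU , x∈u ≈.refl

  ultrafilters-separate : ∀ {x y} → (∀ u → IsUF u → u x ≡ u y) → x ≈ y
  ultrafilters-separate {x} {y} same =
    ≤-antisym (leq λ u uU ux → trans (sym (same u uU)) ux) (leq λ u uU uy → trans (same u uU) uy)
    where
    leq : ∀ {x y} → (∀ u → IsUF u → u x ≡ true → u y ≡ true) → x ≤ y
    leq {x} {y} x⇒y = x·-y≈0⇒x≤y (decidable-stable em↓ λ x-y≉0 →
      let u , uU , x-y∈u = ultrafilter-containing x-y≉0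
          x∈u , -y∈u = ∧-true⁻ {u x} (trans (sym (u-· uU x (- y))) x-y∈u)
      in contradiction (trans (sym (x⇒y u uU x∈u)) (u--⁻ uU -y∈u)) λ ())

  -- The new ultrafilter extends `A` together with the closed elements of `u`. If some `x` in `A`
  -- were disjoint from such an `h`, so would be `c i x`, although both belong to `u`.
  canonical-back : ∀ {i u} {A : Pred Carrier ℓ} → IsUF u → ∃ A → MeetClosed {𝔄 = 𝔄} A →
                   (∀ {x} → A x → u (c i x) ≡ true) →
                   ∃ λ v → IsUF v × (∀ x → u (c i x) ≡ v (c i x)) × (∀ {x} → A x → v x ≡ true)
  canonical-back {i} {u} {A} uU A-nonempty A-closed cA⊆u =
    let v , vU , A⊆v , H⊆v = ultrafilter-extending A-nonempty (1# , u-1 uU , c-1 i) A-closed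
          (λ (ux , cx≈x) (uy , cy≈y) → u-·⁺ uU ux uy , c-·-closed i cx≈x cy≈y)
          (λ Ax (uh , ch≈h) xh≈0 →
            u-≉0 uU (u-·⁺ uU (cA⊆u Ax) uh) (x·y≈0⇒cx·y≈0 i ch≈h xh≈0))
    in v , vU , agree vU H⊆v , A⊆v
    where
    H : Pred Carrier ℓ
    H h = u h ≡ true × c i h ≈ h
    agree : ∀ {v} → IsUF v → (∀ {h} → H h → v h ≡ true) → ∀ x → u (c i x) ≡ v (c i x)
    agree {v} vU H⊆v x with u (c i x) in eq
    ... | true  = sym (H⊆v (eq , c-idem i x))
    -- A closed element outside `u` is handled through its complement, which is closed and in `u`.
    ... | false = sym (u--⁻ vU (H⊆v (u--⁺ uU eq , c-‿closed i (c-idem i x))))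

  -- Between ultrafilters this is the usual relation, that `c i x` is in `u` for each `x` in `v`.
  -- Stated as agreement on cylindrifications it is visibly an equivalence.
  canonicalFrame : Frame I
  canonicalFrame = record
    { World           = Carrier → Bool
    ; Domain          = IsUF
    ; _∼[_]_          = λ u i v → ∀ x → u (c i x) ≡ v (c i x)
    ; ∼-isEquivalence = λ i → record
      { refl  = λ _ → refl
      ; sym   = λ p x → sym (p x)
      ; trans = λ p q x → trans (p x) (q x)
      }
    }

  private module K = Frame canonicalFrame

  -- A surjective bounded morphism onto the ultrafilter frame. Worlds there are functions, so they
  -- are compared pointwise.
  record Covering (F : Frame I) : Set ℓ where
    open Frame F
    field
      π     : World → Carrier → Bool
      π-UF  : ∀ {w} → Domain w → IsUF (π w)
      onto  : ∀ {u} → IsUF u → ∃ λ w → Domain w × (∀ x → π w x ≡ u x)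
      forth : ∀ {i w v} → w ∼[ i ] v → π w K.∼[ i ] π v
      back  : ∀ {i w u} → Domain w → IsUF u → π w K.∼[ i ] u →
              ∃ λ v → Domain v × w ∼[ i ] v × (∀ x → π v x ≡ u x)

    covering-embedding : Embedding 𝔄 (Cm F)
    covering-embedding = record
      { to             = λ x w → π w x
      ; isHomomorphism = record
        { cong   = λ x≈y w d → u-cong (π-UF d) x≈y
        ; ·-homo = λ x y w d → u-· (π-UF d) x y
        ; +-homo = λ x y w d → u-+ (π-UF d) x y
        ; -‿homo = λ x w d → u-- (π-UF d) x
        ; 0-homo = λ w d → u-0 (π-UF d)
        ; 1-homo = λ w d → u-1 (π-UF d)
        ; c-homo = λ i x w d → Bool.⇔→≡ (mk⇔
            (λ cx∈w →
              let u , uU , w∼u , x∈u = canonical-back (π-UF d) (x , ≈.refl) (singleton-closed x)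
                    (λ y≈x → trans (u-cong (π-UF d) (c-cong i y≈x)) cx∈w)
                  v , dv , w∼v , v≡u = back d uU w∼u
              in ⌊⌋⁺ (v , dv , w∼v , trans (v≡u x) (x∈u ≈.refl)))
            (λ ◇x → let v , dv , w∼v , x∈v = ◇⁻ F {i} {λ w → π w x} {w} ◇x in
              trans (forth w∼v x) (u-≤ (π-UF dv) (x≤cx i x) x∈v)))
        }
      ; injective      = λ {x} {y} x≈y → ultrafilters-separate λ u uU →
          let w , d , w≡u = onto uU in trans (sym (w≡u x)) (trans (x≈y w d) (w≡u y))
      }

  canonical-embedding : Embedding 𝔄 (Cm canonicalFrame)
  canonical-embedding = Covering.covering-embedding {F = canonicalFrame} record
    { π     = id
    ; π-UF  = id
    ; onto  = λ {u} uU → u , uU , λ _ → refl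
    ; forth = id
    ; back  = λ {_} {_} {u} _ uU w∼u → u , uU , w∼u , λ _ → refl
    }

  canonical-nonempty : Nondegenerate 𝔄 → ∃ IsUF
  canonical-nonempty 0≉1 =
    let u , uU , _ = ultrafilter-containing (0≉1 ∘ ≈.sym) in u , uU

-- Ultrafilters along an embedding, and amalgamation.

module Extension {ℓ} (classical : Classical ℓ) {I : Set ℓ} {𝔄 𝔅 : Algebra I ℓ ℓ}
                 (satᴬ : SatisfiesAxioms 𝔄) (satᴮ : SatisfiesAxioms 𝔅) (e : Embedding 𝔄 𝔅) where

  private
    module A = Algebra 𝔄
    module B = Algebra 𝔅
    module LA = Laws satᴬ
    module LB = Laws satᴮ
    module CB = CanonicalFrame classical satᴮ
  open Embedding e
  open IsHomomorphism isHomomorphism renaming (cong to to-cong)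
  open IsUltrafilter

  restrict : ∀ {u} → IsUltrafilter 𝔅 u → IsUltrafilter 𝔄 (u ∘ to)
  restrict {u} uU = record
    { u-cong = u-cong uU ∘ to-cong
    ; u-·    = λ x y → trans (u-cong uU (·-homo x y)) (u-· uU _ _)
    ; u-+    = λ x y → trans (u-cong uU (+-homo x y)) (u-+ uU _ _)
    ; u--    = λ x → trans (u-cong uU (-‿homo x)) (u-- uU _)
    ; u-0    = trans (u-cong uU 0-homo) (u-0 uU)
    ; u-1    = trans (u-cong uU 1-homo) (u-1 uU)
    }

  Image : ∀ {p} → Pred A.Carrier p → Pred B.Carrier (ℓ ⊔ p)
  Image P y = ∃ λ x → P x × y B.≈ to x

  image-closed : ∀ {p} {P : Pred A.Carrier p} → MeetClosed {𝔄 = 𝔄} P → MeetClosed {𝔄 = 𝔅} (Image P)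
  image-closed P-closed (x , Px , y≈) (x′ , Px′ , y′≈) =
    x A.· x′ , P-closed Px Px′ , LB.≈.trans (B.·-cong y≈ y′≈) (LB.≈.sym (·-homo x x′))

  image-⊆⇒≡ : ∀ {u w} → IsUltrafilter 𝔅 u → IsUltrafilter 𝔄 w →
              (∀ {y} → Image (λ x → w x ≡ true) y → u y ≡ true) → ∀ x → u (to x) ≡ w x
  image-⊆⇒≡ uU wU w⊆u x =
    sym (ultrafilter-⊆⇒≡ wU (restrict uU) (λ {z} wz → w⊆u (z , wz , LB.≈.refl)) x)

  extend-with : ∀ {x w} → IsUltrafilter 𝔄 w → (∀ {z} → w z ≡ true → ¬ (x B.· to z B.≈ B.0#)) →
                ∃ λ u → IsUltrafilter 𝔅 u × u x ≡ true × (∀ z → u (to z) ≡ w z)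
  extend-with {x} wU x·w≉0 =
    let u , uU , x∈u , w⊆u = CB.ultrafilter-extending (x , LB.≈.refl) (to A.1# , A.1# , u-1 wU , LB.≈.refl)
          (CB.singleton-closed x) (image-closed (u-·⁺ wU))
          (λ g≈x (z , wz , h≈) gh≈0 →
            x·w≉0 wz (LB.≈.trans (LB.≈.sym (B.·-cong g≈x h≈)) gh≈0))
    in u , uU , x∈u LB.≈.refl , image-⊆⇒≡ uU wU w⊆u

  extend : ∀ {w} → IsUltrafilter 𝔄 w → ∃ λ u → IsUltrafilter 𝔅 u × (∀ z → u (to z) ≡ w z)
  extend wU =
    let u , uU , _ , u≡w = extend-with {B.1#} wU λ wz 1z≈0 →
          u-≉0 wU wz (injective (LB.≈.trans (LB.≈.sym (LB.∧-identityˡ _)) (LB.≈.trans 1z≈0 (LB.≈.sym 0-homo))))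
    in u , uU , u≡w

  -- The back condition for `restrict`. Cylindrifications of the image of `w` lie in `u` because `z`
  -- is below `c i z`, and an ultrafilter containing that image restricts to exactly `w`.
  extend-back : ∀ {i u w} → IsUltrafilter 𝔅 u → IsUltrafilter 𝔄 w →
                (∀ z → u (to (A.c i z)) ≡ w (A.c i z)) →
                ∃ λ v → IsUltrafilter 𝔅 v × (∀ x → u (B.c i x) ≡ v (B.c i x)) ×
                        (∀ z → v (to z) ≡ w z)
  extend-back {i} uU wU u∼w =
    let v , vU , u∼v , w⊆v = CB.canonical-back uU (to A.1# , A.1# , u-1 wU , LB.≈.refl)
          (image-closed (u-·⁺ wU))
          (λ (z , wz , y≈) → trans (u-cong uU (LB.≈.trans (B.c-cong i y≈) (LB.≈.sym (c-homo i z))))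
            (trans (u∼w z) (u-≤ wU (LA.x≤cx i z) wz)))
    in v , vU , u∼v , image-⊆⇒≡ vU wU w⊆v

module Amalgam {ℓ} (classical : Classical ℓ) {I : Set ℓ} {𝔄₀ 𝔄₁ 𝔄₂ : Algebra I ℓ ℓ}
               (sat₀ : SatisfiesAxioms 𝔄₀) (sat₁ : SatisfiesAxioms 𝔄₁)
               (sat₂ : SatisfiesAxioms 𝔄₂) (e₁ : Embedding 𝔄₀ 𝔄₁) (e₂ : Embedding 𝔄₀ 𝔄₂) where

  open Complex (Classical.excludedMiddle classical)
  private
    module A₀ = Algebra 𝔄₀
    module A₁ = Algebra 𝔄₁
    module A₂ = Algebra 𝔄₂
    module L₁ = Laws sat₁
    module L₂ = Laws sat₂
    module C₁ = CanonicalFrame classical sat₁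
    module C₂ = CanonicalFrame classical sat₂
    module X₁ = Extension classical sat₀ sat₁ e₁
    module X₂ = Extension classical sat₀ sat₂ e₂
    module K₁ = Frame C₁.canonicalFrame
    module K₂ = Frame C₂.canonicalFrame
    module E₁ = Embedding e₁
    module E₂ = Embedding e₂
    module H₁ = IsHomomorphism E₁.isHomomorphism
  open IsUltrafilter

  pairs : Frame I
  pairs = record
    { World           = (A₁.Carrier → Bool) × (A₂.Carrier → Bool)
    ; Domain          = λ (u , v) → IsUltrafilter 𝔄₁ u × IsUltrafilter 𝔄₂ v ×
                                    (∀ z → u (E₁.to z) ≡ v (E₂.to z))
    ; _∼[_]_          = λ (u , v) i (u′ , v′) → u K₁.∼[ i ] u′ × v K₂.∼[ i ] v′
    ; ∼-isEquivalence = λ i → record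
      { refl  = (λ _ → refl) , (λ _ → refl)
      ; sym   = λ (p , q) → (λ x → sym (p x)) , (λ x → sym (q x))
      ; trans = λ (p , q) (p′ , q′) → (λ x → trans (p x) (p′ x)) , (λ x → trans (q x) (q′ x))
      }
    }

  module P = Frame pairs

  -- When the first component moves, `extend-back` moves the second one to match the restriction of
  -- the new first component.
  covering₁ : C₁.Covering pairs
  covering₁ = record
    { π     = proj₁
    ; π-UF  = proj₁
    ; onto  = λ {u} uU → let v , vU , v≡u = X₂.extend (X₁.restrict uU) in
        (u , v) , (uU , vU , λ z → sym (v≡u z)) , λ _ → refl
    ; forth = proj₁
    ; back  = λ {i} {w} {u′} (uU , vU , u≡v) uU′ u∼u′ →
        let v′ , vU′ , v∼v′ , v′≡u′ = X₂.extend-back {i} vU (X₁.restrict uU′) λ z →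
              trans (sym (u≡v (A₀.c i z))) (trans (u-cong uU (H₁.c-homo i z))
                (trans (u∼u′ (E₁.to z)) (sym (u-cong uU′ (H₁.c-homo i z)))))
        in (u′ , v′) , (uU′ , vU′ , λ z → sym (v′≡u′ z)) , (u∼u′ , v∼v′) , λ _ → refl
    }

  pairs-nonempty : Nondegenerate 𝔄₁ → ∃ P.Domain
  pairs-nonempty 0≉1 =
    let u , uU = C₁.canonical-nonempty 0≉1
        w , d , _ = C₁.Covering.onto covering₁ uU
    in w , d

  -- If there is none, some ultrafilter `v` contains `- y` and the images of all `z` above `x`. Its
  -- restriction is compatible with `x`: a member `z` disjoint from `x` would put `- z` above `x`,
  -- hence also in the restriction. So a pair arises with `x` in `u` but `y` not in `v`.
  interpolant : ∀ x y → (∀ {w} → P.Domain w → proj₁ w x ≡ true → proj₂ w y ≡ true) →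
                ∃ λ z → (x A₁.≤ E₁.to z) × (E₂.to z A₂.≤ y)
  interpolant x y x⇒y = decidable-stable em↓ λ ¬∃ →
    let v , vU , -y∈v , F⊆v = C₂.ultrafilter-extending
          (A₂.- y , L₂.≈.refl) (E₂.to A₀.1# , A₀.1# , x≤₁1 , L₂.≈.refl)
          (C₂.singleton-closed (A₂.- y)) (X₂.image-closed {P = Above} above-closed)
          (λ g≈-y (z , x≤z , h≈) gh≈0 → ¬∃ (z , x≤z , L₂.x·-y≈0⇒x≤y (L₂.≈.trans (L₂.∧-comm _ _)
            (L₂.≈.trans (L₂.≈.sym (A₂.·-cong g≈-y h≈)) gh≈0))))
        u , uU , x∈u , u≡v = X₁.extend-with {x} (X₂.restrict vU) (λ {z} z∈v xz≈0 →
          let -z∈v = F⊆v (A₀.- z , x≤₁-z xz≈0 , L₂.≈.refl) in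
          contradiction (trans (sym z∈v) (u--⁻ (X₂.restrict vU) -z∈v)) λ ())
    in contradiction (trans (sym (x⇒y (uU , vU , u≡v) x∈u)) (u--⁻ vU (-y∈v L₂.≈.refl))) λ ()
    where
    Above : Pred A₀.Carrier ℓ
    Above z = x A₁.≤ E₁.to z
    above-closed : MeetClosed {𝔄 = 𝔄₀} Above
    above-closed x≤z x≤z′ = L₁.≤-trans (L₁.≤-glb x≤z x≤z′) (L₁.≈⇒≤ (L₁.≈.sym (H₁.·-homo _ _)))
    x≤₁1 : Above A₀.1#
    x≤₁1 = L₁.≤-trans (L₁.x≤1 x) (L₁.≈⇒≤ (L₁.≈.sym H₁.1-homo))
    x≤₁-z : ∀ {z} → x A₁.· E₁.to z A₁.≈ A₁.0# → Above (A₀.- z)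
    x≤₁-z xz≈0 = L₁.≤-trans (L₁.x·y≈0⇒x≤-y xz≈0) (L₁.≈⇒≤ (L₁.≈.sym (H₁.-‿homo _)))

-- Obtained by symmetry from `covering₁` with the two algebras exchanged.
covering₂ : ∀ {ℓ} (classical : Classical ℓ) {I : Set ℓ} {𝔄₀ 𝔄₁ 𝔄₂ : Algebra I ℓ ℓ}
  (sat₀ : SatisfiesAxioms 𝔄₀) (sat₁ : SatisfiesAxioms 𝔄₁) (sat₂ : SatisfiesAxioms 𝔄₂)
  (e₁ : Embedding 𝔄₀ 𝔄₁) (e₂ : Embedding 𝔄₀ 𝔄₂) →
  CanonicalFrame.Covering classical sat₂ (Amalgam.pairs classical sat₀ sat₁ sat₂ e₁ e₂)
covering₂ classical sat₀ sat₁ sat₂ e₁ e₂ = record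
  { π     = proj₂
  ; π-UF  = proj₁ ∘ proj₂
  ; onto  = λ uU → let w , d , p = S.onto uU in swap w , swap-domain d , p
  ; forth = proj₂
  ; back  = λ d uU w∼u → let v , d′ , w∼v , p = S.back (swap-domain′ d) uU w∼u in
      swap v , swap-domain d′ , swap w∼v , p
  }
  where
  module S = CanonicalFrame.Covering (Amalgam.covering₁ classical sat₀ sat₂ sat₁ e₂ e₁)
  module P = Frame (Amalgam.pairs classical sat₀ sat₁ sat₂ e₁ e₂)
  module Q = Frame (Amalgam.pairs classical sat₀ sat₂ sat₁ e₂ e₁)
  swap-domain : ∀ {w} → Q.Domain w → P.Domain (swap w)
  swap-domain (uU , vU , p) = vU , uU , λ z → sym (p z)
  swap-domain′ : ∀ {w} → P.Domain w → Q.Domain (swap w)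
  swap-domain′ (uU , vU , p) = vU , uU , λ z → sym (p z)

-- Finite quasimodels and the search through them.

module _ {a} {A : Set a} where

  sublists : List A → List (List A)
  sublists []       = [] ∷ []
  sublists (x ∷ xs) = map (x ∷_) (sublists xs) ++ sublists xs

  filter∈sublists : ∀ {p} {P : Pred A p} (P? : ∀ x → Dec (P x)) xs → filter P? xs ∈ sublists xs
  filter∈sublists P? [] = here refl
  filter∈sublists P? (x ∷ xs) with does (P? x)
  ... | true  = ∈-++⁺ˡ (∈-map⁺ (x ∷_) (filter∈sublists P? xs))
  ... | false = ∈-++⁺ʳ (map (x ∷_) (sublists xs)) (filter∈sublists P? xs)

bools : List Bool
bools = true ∷ false ∷ []

bools-complete : ∀ b → b ∈ bools
bools-complete true  = here refl
bools-complete false = there (here refl)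

vectors : ∀ n → List (Vec Bool n)
vectors ℕ.zero    = [] ∷ []
vectors (ℕ.suc n) = cartesianProductWith _∷_ bools (vectors n)

vectors-complete : ∀ {n} (bs : Vec Bool n) → bs ∈ vectors n
vectors-complete []       = here refl
vectors-complete (b ∷ bs) =
  ∈-cartesianProductWith⁺ _∷_ (bools-complete b) (vectors-complete bs)

tabulateℕ : ∀ n → (ℕ → Bool) → Vec Bool n
tabulateℕ ℕ.zero    f = []
tabulateℕ (ℕ.suc n) f = f 0 ∷ tabulateℕ n (f ∘ ℕ.suc)

lookupℕ : ∀ {n} → Vec Bool n → ℕ → Bool
lookupℕ []       m         = false
lookupℕ (b ∷ bs) ℕ.zero    = b
lookupℕ (b ∷ bs) (ℕ.suc m) = lookupℕ bs m

lookupℕ-tabulateℕ : ∀ {m n} → m ℕ.< n → ∀ f → lookupℕ (tabulateℕ n f) m ≡ f m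
lookupℕ-tabulateℕ {ℕ.zero}  (s≤s _)   f = refl
lookupℕ-tabulateℕ {ℕ.suc m} (s≤s m<n) f = lookupℕ-tabulateℕ m<n (f ∘ ℕ.suc)

module _ {ι} {I : Set ι} where

  variableBound : Term I → ℕ
  variableBound (var n)  = ℕ.suc n
  variableBound (t ·ᵗ u) = variableBound t ℕ.⊔ variableBound u
  variableBound (t +ᵗ u) = variableBound t ℕ.⊔ variableBound u
  variableBound (-ᵗ t)   = variableBound t
  variableBound 0ᵗ       = 0
  variableBound 1ᵗ       = 0
  variableBound (cᵗ i t) = variableBound t

  depth : Term I → ℕ
  depth (var n)  = 0
  depth (t ·ᵗ u) = depth t ℕ.⊔ depth u
  depth (t +ᵗ u) = depth t ℕ.⊔ depth u
  depth (-ᵗ t)   = depth t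
  depth 0ᵗ       = 0
  depth 1ᵗ       = 0
  depth (cᵗ i t) = ℕ.suc (depth t)

  indices : Term I → List I
  indices (var n)  = []
  indices (t ·ᵗ u) = indices t ++ indices u
  indices (t +ᵗ u) = indices t ++ indices u
  indices (-ᵗ t)   = indices t
  indices 0ᵗ       = []
  indices 1ᵗ       = []
  indices (cᵗ i t) = i ∷ indices t

  -- Guessed truth values for the occurrences of cylindrifications in a term.
  Guess : Term I → Set ι
  Guess (var n)  = ⊤
  Guess (t ·ᵗ u) = Guess t × Guess u
  Guess (t +ᵗ u) = Guess t × Guess u
  Guess (-ᵗ t)   = Guess t
  Guess 0ᵗ       = ⊤
  Guess 1ᵗ       = ⊤
  Guess (cᵗ i t) = Bool × Guess t

  guesses : ∀ t → List (Guess t)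
  guesses (var n)  = tt ∷ []
  guesses (t ·ᵗ u) = cartesianProduct (guesses t) (guesses u)
  guesses (t +ᵗ u) = cartesianProduct (guesses t) (guesses u)
  guesses (-ᵗ t)   = guesses t
  guesses 0ᵗ       = tt ∷ []
  guesses 1ᵗ       = tt ∷ []
  guesses (cᵗ i t) = cartesianProduct bools (guesses t)

  guesses-complete : ∀ t (γ : Guess t) → γ ∈ guesses t
  guesses-complete (var n)  _       = here refl
  guesses-complete (t ·ᵗ u) (γ , δ) = ∈-cartesianProduct⁺ (guesses-complete t γ) (guesses-complete u δ)
  guesses-complete (t +ᵗ u) (γ , δ) = ∈-cartesianProduct⁺ (guesses-complete t γ) (guesses-complete u δ)
  guesses-complete (-ᵗ t)   γ       = guesses-complete t γ
  guesses-complete 0ᵗ       _       = here refl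
  guesses-complete 1ᵗ       _       = here refl
  guesses-complete (cᵗ i t) (b , γ) = ∈-cartesianProduct⁺ (bools-complete b) (guesses-complete t γ)

  value : (ℕ → Bool) → ∀ t → Guess t → Bool
  value ρ (var n)  _       = ρ n
  value ρ (t ·ᵗ u) (γ , δ) = value ρ t γ ∧ value ρ u δ
  value ρ (t +ᵗ u) (γ , δ) = value ρ t γ ∨ value ρ u δ
  value ρ (-ᵗ t)   γ       = not (value ρ t γ)
  value ρ 0ᵗ       _       = false
  value ρ 1ᵗ       _       = true
  value ρ (cᵗ i t) (b , _) = b

  -- The part of a quasimodel that is local to one point: it expresses that the relations are
  -- reflexive.
  Coherent : (ℕ → Bool) → ∀ t → Guess t → Set
  Coherent ρ (var n)  _       = ⊤
  Coherent ρ (t ·ᵗ u) (γ , δ) = Coherent ρ t γ × Coherent ρ u δ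
  Coherent ρ (t +ᵗ u) (γ , δ) = Coherent ρ t γ × Coherent ρ u δ
  Coherent ρ (-ᵗ t)   γ       = Coherent ρ t γ
  Coherent ρ 0ᵗ       _       = ⊤
  Coherent ρ 1ᵗ       _       = ⊤
  Coherent ρ (cᵗ i t) (b , γ) = (value ρ t γ ≡ true → b ≡ true) × Coherent ρ t γ

  coherent? : ∀ ρ t γ → Dec (Coherent ρ t γ)
  coherent? ρ (var n)  _       = yes tt
  coherent? ρ (t ·ᵗ u) (γ , δ) = coherent? ρ t γ ×-dec coherent? ρ u δ
  coherent? ρ (t +ᵗ u) (γ , δ) = coherent? ρ t γ ×-dec coherent? ρ u δ
  coherent? ρ (-ᵗ t)   γ       = coherent? ρ t γ
  coherent? ρ 0ᵗ       _       = yes tt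
  coherent? ρ 1ᵗ       _       = yes tt
  coherent? ρ (cᵗ i t) (b , γ) = ((value ρ t γ Bool.≟ true) →-dec (b Bool.≟ true)) ×-dec coherent? ρ t γ

  -- The filtration relation for `i`. It compares only cylindrifications with that index.
  Agree : I → ∀ t → Guess t → Guess t → Set ι
  Agree i (var n)  _       _         = ⊤
  Agree i (t ·ᵗ u) (γ , δ) (γ′ , δ′) = Agree i t γ γ′ × Agree i u δ δ′
  Agree i (t +ᵗ u) (γ , δ) (γ′ , δ′) = Agree i t γ γ′ × Agree i u δ δ′
  Agree i (-ᵗ t)   γ       γ′        = Agree i t γ γ′
  Agree i 0ᵗ       _       _         = ⊤
  Agree i 1ᵗ       _       _         = ⊤
  Agree i (cᵗ j t) (b , γ) (b′ , γ′) = (j ≡ i → b ≡ b′) × Agree i t γ γ′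

  agree-refl : ∀ i t {γ} → Agree i t γ γ
  agree-refl i (var n)  = tt
  agree-refl i (t ·ᵗ u) = agree-refl i t , agree-refl i u
  agree-refl i (t +ᵗ u) = agree-refl i t , agree-refl i u
  agree-refl i (-ᵗ t)   = agree-refl i t
  agree-refl i 0ᵗ       = tt
  agree-refl i 1ᵗ       = tt
  agree-refl i (cᵗ j t) = (λ _ → refl) , agree-refl i t

  agree-sym : ∀ i t {γ δ} → Agree i t γ δ → Agree i t δ γ
  agree-sym i (var n)  _       = tt
  agree-sym i (t ·ᵗ u) (p , q) = agree-sym i t p , agree-sym i u q
  agree-sym i (t +ᵗ u) (p , q) = agree-sym i t p , agree-sym i u q
  agree-sym i (-ᵗ t)   p       = agree-sym i t p
  agree-sym i 0ᵗ       _       = tt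
  agree-sym i 1ᵗ       _       = tt
  agree-sym i (cᵗ j t) (p , q) = sym ∘ p , agree-sym i t q

  agree-trans : ∀ i t {γ δ ε} → Agree i t γ δ → Agree i t δ ε → Agree i t γ ε
  agree-trans i (var n)  _       _         = tt
  agree-trans i (t ·ᵗ u) (p , q) (p′ , q′) = agree-trans i t p p′ , agree-trans i u q q′
  agree-trans i (t +ᵗ u) (p , q) (p′ , q′) = agree-trans i t p p′ , agree-trans i u q q′
  agree-trans i (-ᵗ t)   p       p′        = agree-trans i t p p′
  agree-trans i 0ᵗ       _       _         = tt
  agree-trans i 1ᵗ       _       _         = tt
  agree-trans i (cᵗ j t) (p , q) (p′ , q′) = (λ eq → trans (p eq) (p′ eq)) , agree-trans i t q q′

  record Point (r : Term I) : Set ι where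
    constructor point
    field
      atoms : Vec Bool (variableBound r)
      guess : Guess r

  open Point public

  points : ∀ r → List (Point r)
  points r = cartesianProductWith point (vectors (variableBound r)) (guesses r)

  points-complete : ∀ r p → p ∈ points r
  points-complete r (point bs γ) =
    ∈-cartesianProductWith⁺ point (vectors-complete bs) (guesses-complete r γ)

  valueAt : ∀ {r} t → (Point r → Guess t) → Point r → Bool
  valueAt t π p = value (lookupℕ (atoms p)) t (π p)

  -- The occurrence of t in r is described by the projection of guesses.
  Saturated : ∀ {r} → List (Point r) → ∀ t → (Point r → Guess t) → Set ι
  Saturated S (var n)  π = ⊤
  Saturated S (t ·ᵗ u) π = Saturated S t (proj₁ ∘ π) × Saturated S u (proj₂ ∘ π)
  Saturated S (t +ᵗ u) π = Saturated S t (proj₁ ∘ π) × Saturated S u (proj₂ ∘ π)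
  Saturated S (-ᵗ t)   π = Saturated S t π
  Saturated S 0ᵗ       π = ⊤
  Saturated S 1ᵗ       π = ⊤
  Saturated {r} S (cᵗ i t) π =
    All (λ p → proj₁ (π p) ≡ true →
      Any (λ q → Agree i r (guess p) (guess q) × valueAt t (proj₂ ∘ π) q ≡ true) S) S ×
    Saturated S t (proj₂ ∘ π)

  Quasimodel : ∀ {r} → List (Point r) → Set ι
  Quasimodel {r} S = All (λ p → Coherent (lookupℕ (atoms p)) r (guess p)) S × Saturated S r guess

  -- The product `t ·ᵗ u` merely bundles the two sides, so that one point carries guesses for both.
  Refutes : ∀ t u → List (Point (t ·ᵗ u)) → Set ι
  Refutes t u S =
    Quasimodel S × Any (λ p → valueAt t (proj₁ ∘ guess) p ≢ valueAt u (proj₂ ∘ guess) p) S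

module _ {ℓ} (α : Ordinal ℓ) where

  private module α = Ordinal α

  -- Constructive, since equality of indices is decidable in every `Ordinal`.
  agree? : ∀ i t γ δ → Dec (Agree {I = α.Carrier} i t γ δ)
  agree? i (var n)  _       _         = yes tt
  agree? i (t ·ᵗ u) (γ , δ) (γ′ , δ′) = agree? i t γ γ′ ×-dec agree? i u δ δ′
  agree? i (t +ᵗ u) (γ , δ) (γ′ , δ′) = agree? i t γ γ′ ×-dec agree? i u δ δ′
  agree? i (-ᵗ t)   γ       γ′        = agree? i t γ γ′
  agree? i 0ᵗ       _       _         = yes tt
  agree? i 1ᵗ       _       _         = yes tt
  agree? i (cᵗ j t) (b , γ) (b′ , γ′) = ((j α.≟ i) →-dec (b Bool.≟ b′)) ×-dec agree? i t γ γ′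

  saturated? : ∀ {r : Term α.Carrier} S t (π : Point r → Guess t) → Dec (Saturated S t π)
  saturated? S (var n)  π = yes tt
  saturated? S (t ·ᵗ u) π = saturated? S t (proj₁ ∘ π) ×-dec saturated? S u (proj₂ ∘ π)
  saturated? S (t +ᵗ u) π = saturated? S t (proj₁ ∘ π) ×-dec saturated? S u (proj₂ ∘ π)
  saturated? S (-ᵗ t)   π = saturated? S t π
  saturated? S 0ᵗ       π = yes tt
  saturated? S 1ᵗ       π = yes tt
  saturated? {r} S (cᵗ i t) π =
    All.all? (λ p → (proj₁ (π p) Bool.≟ true) →-dec
      Any.any? (λ q → agree? i r (guess p) (guess q) ×-dec (valueAt t (proj₂ ∘ π) q Bool.≟ true)) S) S
    ×-dec saturated? S t (proj₂ ∘ π)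

  refutes? : ∀ t u S → Dec (Refutes {I = α.Carrier} t u S)
  refutes? t u S =
    (All.all? (λ p → coherent? (lookupℕ (atoms p)) (t ·ᵗ u) (guess p)) S
      ×-dec saturated? S (t ·ᵗ u) guess)
    ×-dec Any.any? (λ p → ¬? (valueAt t (proj₁ ∘ guess) p Bool.≟ valueAt u (proj₂ ∘ guess) p)) S

  -- The points of a filtration are obtained by filtering `points`, so a search through its sublists
  -- cannot miss them.
  Refutable : Equation α.Carrier → Set ℓ
  Refutable (t ≈ᵗ u) = Any (Refutes t u) (sublists (points (t ·ᵗ u)))

  refutable? : ∀ e → Dec (Refutable e)
  refutable? (t ≈ᵗ u) = Any.any? (refutes? t u) (sublists (points (t ·ᵗ u)))

quasiFrame : ∀ {ℓ} {I : Set ℓ} {r : Term I} → List (Point r) → Frame I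
quasiFrame {r = r} S = record
  { World           = Point r
  ; Domain          = _∈ S
  ; _∼[_]_          = λ p i q → Agree i r (guess p) (guess q)
  ; ∼-isEquivalence = λ i → record
    { refl  = agree-refl i r
    ; sym   = agree-sym i r
    ; trans = agree-trans i r
    }
  }

quasiValuation : ∀ {ι} {I : Set ι} {r : Term I} → ℕ → Point r → Bool
quasiValuation n p = lookupℕ (atoms p) n

-- Correctness: truth in quasimodels, filtration and truncated trees.

module Correctness {ℓ} (em : ExcludedMiddle (suc ℓ)) where

  open Complex em

  module _ {I : Set ℓ} {r : Term I} {S : List (Point r)} where

    private
      Q : Algebra I ℓ ℓ
      Q = Cm (quasiFrame S)

    -- For a cylindrification, coherence makes the guess true at a witness and agreement carries it
    -- back to `p`; conversely saturation supplies a witness for a true guess.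
    quasi-truth : ∀ t (π : Point r → Guess t) →
      (∀ i {p q} → Agree i r (guess p) (guess q) → Agree i t (π p) (π q)) →
      (∀ {p} → p ∈ S → Coherent (lookupℕ (atoms p)) t (π p)) → Saturated S t π →
      ∀ {p} → p ∈ S → eval Q quasiValuation t p ≡ valueAt t π p
    quasi-truth (var n)  π agr coh sat p∈ = refl
    quasi-truth (t ·ᵗ u) π agr coh (sat , sat′) p∈ = cong₂ _∧_
      (quasi-truth t (proj₁ ∘ π) (λ i → proj₁ ∘ agr i) (proj₁ ∘ coh) sat p∈)
      (quasi-truth u (proj₂ ∘ π) (λ i → proj₂ ∘ agr i) (proj₂ ∘ coh) sat′ p∈)
    quasi-truth (t +ᵗ u) π agr coh (sat , sat′) p∈ = cong₂ _∨_
      (quasi-truth t (proj₁ ∘ π) (λ i → proj₁ ∘ agr i) (proj₁ ∘ coh) sat p∈)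
      (quasi-truth u (proj₂ ∘ π) (λ i → proj₂ ∘ agr i) (proj₂ ∘ coh) sat′ p∈)
    quasi-truth (-ᵗ t)   π agr coh sat p∈ = cong not (quasi-truth t π agr coh sat p∈)
    quasi-truth 0ᵗ       π agr coh sat p∈ = refl
    quasi-truth 1ᵗ       π agr coh sat p∈ = refl
    quasi-truth (cᵗ i t) π agr coh (witnessed , sat) {p} p∈ = Bool.⇔→≡ (mk⇔
      (λ ◇t → let q , q∈ , p∼q , tq = ◇⁻ (quasiFrame S) {i} {eval Q quasiValuation t} {p} ◇t in
        trans (proj₁ (agr i p∼q) refl) (proj₁ (coh q∈) (trans (sym (IH q∈)) tq)))
      (λ b → let q , q∈ , p∼q , tq = find (All.lookup witnessed p∈ b) in
        ⌊⌋⁺ (q , q∈ , p∼q , trans (IH q∈) tq)))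
      where
      IH : ∀ {q} → q ∈ S → eval Q quasiValuation t q ≡ valueAt t (proj₂ ∘ π) q
      IH = quasi-truth t (proj₂ ∘ π) (λ i → proj₂ ∘ agr i) (proj₂ ∘ coh) sat

  module Filtration {I : Set ℓ} (F : Frame I) (v : ℕ → Frame.World F → Bool) where

    open Frame F
    open import Data.Nat.Base using (_≤_; _<_)

    trueGuess : ∀ t → World → Guess t
    trueGuess (var n)  w = tt
    trueGuess (t ·ᵗ u) w = trueGuess t w , trueGuess u w
    trueGuess (t +ᵗ u) w = trueGuess t w , trueGuess u w
    trueGuess (-ᵗ t)   w = trueGuess t w
    trueGuess 0ᵗ       w = tt
    trueGuess 1ᵗ       w = tt
    trueGuess (cᵗ i t) w = eval (Cm F) v (cᵗ i t) w , trueGuess t w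

    Describes : (ℕ → Bool) → World → Term I → Set
    Describes ρ w t = ∀ {n} → n < variableBound t → ρ n ≡ v n w

    module _ {ρ : ℕ → Bool} {w : World} where

      describes-left : ∀ m n → (∀ {k} → k < m ℕ.⊔ n → ρ k ≡ v k w) → ∀ {k} → k < m → ρ k ≡ v k w
      describes-left m n f k<m = f (ℕ.≤-trans k<m (ℕ.m≤m⊔n m n))

      describes-right : ∀ m n → (∀ {k} → k < m ℕ.⊔ n → ρ k ≡ v k w) → ∀ {k} → k < n → ρ k ≡ v k w
      describes-right m n f k<n = f (ℕ.≤-trans k<n (ℕ.m≤n⊔m m n))

      value-true : ∀ t → Describes ρ w t → value ρ t (trueGuess t w) ≡ eval (Cm F) v t w
      value-true (var n)  f = f ℕ.≤-refl
      value-true (t ·ᵗ u) f = cong₂ _∧_ (value-true t (describes-left (variableBound t) _ f))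
                                        (value-true u (describes-right (variableBound t) _ f))
      value-true (t +ᵗ u) f = cong₂ _∨_ (value-true t (describes-left (variableBound t) _ f))
                                        (value-true u (describes-right (variableBound t) _ f))
      value-true (-ᵗ t)   f = cong not (value-true t f)
      value-true 0ᵗ       f = refl
      value-true 1ᵗ       f = refl
      value-true (cᵗ i t) f = refl

      coherent-true : Domain w → ∀ t → Describes ρ w t → Coherent ρ t (trueGuess t w)
      coherent-true d (var n)  f = tt
      coherent-true d (t ·ᵗ u) f = coherent-true d t (describes-left (variableBound t) _ f) ,
                                   coherent-true d u (describes-right (variableBound t) _ f)
      coherent-true d (t +ᵗ u) f = coherent-true d t (describes-left (variableBound t) _ f) ,
                                   coherent-true d u (describes-right (variableBound t) _ f)
      coherent-true d (-ᵗ t)   f = coherent-true d t f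
      coherent-true d 0ᵗ       f = tt
      coherent-true d 1ᵗ       f = tt
      coherent-true d (cᵗ i t) f =
        (λ tw → ⌊⌋⁺ (w , d , ∼.refl , trans (sym (value-true t f)) tw)) , coherent-true d t f

    agree-true : ∀ {i w w′} → w ∼[ i ] w′ → ∀ t → Agree i t (trueGuess t w) (trueGuess t w′)
    agree-true w∼w′ (var n)  = tt
    agree-true w∼w′ (t ·ᵗ u) = agree-true w∼w′ t , agree-true w∼w′ u
    agree-true w∼w′ (t +ᵗ u) = agree-true w∼w′ t , agree-true w∼w′ u
    agree-true w∼w′ (-ᵗ t)   = agree-true w∼w′ t
    agree-true w∼w′ 0ᵗ       = tt
    agree-true w∼w′ 1ᵗ       = tt
    agree-true w∼w′ (cᵗ j t) =
      (λ { refl → ⌊⌋-ext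
        (λ (x , d , w∼x , tx) → x , d , ∼.trans (∼.sym w∼w′) w∼x , tx)
        (λ (x , d , w′∼x , tx) → x , d , ∼.trans w∼w′ w′∼x , tx) }) ,
      agree-true w∼w′ t

    module _ (r : Term I) where

      describe : World → Point r
      describe w = point (tabulateℕ _ (λ n → v n w)) (trueGuess r w)

      describes : ∀ w → Describes (lookupℕ (atoms (describe w))) w r
      describes w n< = lookupℕ-tabulateℕ n< (λ n → v n w)

      Realized : Pred (Point r) ℓ
      Realized p = ∃ λ w → Domain w × p ≡ describe w

      -- Filtering by a classical decision is harmless: only the existence of this list is used, in
      -- the proof that the search succeeds.
      realized : List (Point r)
      realized = filter (λ p → em↓ {Realized p}) (points r)

      describe∈realized : ∀ {w} → Domain w → describe w ∈ realized
      describe∈realized {w} d =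
        ∈-filter⁺ (λ p → em↓ {Realized p}) (points-complete r _) (w , d , refl)

      realized⁻ : ∀ {p} → p ∈ realized → Realized p
      realized⁻ p∈ = proj₂ (∈-filter⁻ (λ p → em↓ {Realized p}) {xs = points r} p∈)

      saturated-true : ∀ t (π : Point r → Guess t) → variableBound t ≤ variableBound r →
                       (∀ w → π (describe w) ≡ trueGuess t w) → Saturated realized t π
      saturated-true (var n)  π b π≡ = tt
      saturated-true (t ·ᵗ u) π b π≡ =
        saturated-true t (proj₁ ∘ π) (ℕ.≤-trans (ℕ.m≤m⊔n _ _) b) (cong proj₁ ∘ π≡) ,
        saturated-true u (proj₂ ∘ π) (ℕ.≤-trans (ℕ.m≤n⊔m (variableBound t) _) b) (cong proj₂ ∘ π≡)
      saturated-true (t +ᵗ u) π b π≡ =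
        saturated-true t (proj₁ ∘ π) (ℕ.≤-trans (ℕ.m≤m⊔n _ _) b) (cong proj₁ ∘ π≡) ,
        saturated-true u (proj₂ ∘ π) (ℕ.≤-trans (ℕ.m≤n⊔m (variableBound t) _) b) (cong proj₂ ∘ π≡)
      saturated-true (-ᵗ t)   π b π≡ = saturated-true t π b π≡
      saturated-true 0ᵗ       π b π≡ = tt
      saturated-true 1ᵗ       π b π≡ = tt
      saturated-true (cᵗ i t) π b π≡ =
        All.tabulate witness , saturated-true t (proj₂ ∘ π) b (cong proj₂ ∘ π≡)
        where
        witness : ∀ {p} → p ∈ realized → proj₁ (π p) ≡ true →
          Any (λ q → Agree i r (guess p) (guess q) × valueAt t (proj₂ ∘ π) q ≡ true) realized
        witness p∈ b≡true with realized⁻ p∈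
        ... | w , _ , refl =
          -- A true guess at a realized point is a true cylindrification at a world `w`; the
          -- description of the world `x` that witnesses it is the required point.
          let x , d , w∼x , tx = ◇⁻ F {i} {eval (Cm F) v t} {w}
                (trans (sym (cong proj₁ (π≡ w))) b≡true)
          in lose (describe∈realized d) (agree-true w∼x r ,
               trans (cong (value _ t) (cong proj₂ (π≡ x)))
                 (trans (value-true t λ n< → describes x (ℕ.≤-trans n< b)) tx))

      realized-quasimodel : Quasimodel realized
      realized-quasimodel =
        All.tabulate coherent ,
        saturated-true r guess ℕ.≤-refl (λ _ → refl)
        where
        coherent : ∀ {p} → p ∈ realized → Coherent (lookupℕ (atoms p)) r (guess p)
        coherent p∈ with w , d , refl ← realized⁻ p∈ = coherent-true d r (describes w)

  module _ (α : Ordinal ℓ) (2≤α : 2≤ α) where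

    open Representability em α
    open Unravelling em α 2≤α
    private module α = Ordinal α

    ⊭⇒refutable : ∀ {𝔄} → Drs α 𝔄 → ∀ e → ¬ (𝔄 ⊨ e) → Refutable α e
    ⊭⇒refutable 𝔄∈Drs (t ≈ᵗ u) 𝔄⊭e =
      let F , _ , h = Drs⇒frame 𝔄∈Drs
          v , w , d , t≢u = ¬⊨⇒countermodel F t u (𝔄⊭e ∘ embedding-reflects-⊨ h (t ≈ᵗ u))
          open Filtration F v
          r = t ·ᵗ u
          f = λ {n} → describes r w {n}
      in lose (filter∈sublists _ (points r))
           (realized-quasimodel r ,
            lose (describe∈realized r d) λ t≡u → t≢u
              (trans (sym (value-true t (describes-left (variableBound t) _ f)))
                (trans t≡u (value-true u (describes-right (variableBound t) _ f)))))

    module Truncation {r : Term α.Carrier} (S : List (Point r)) (Ls : List α.Carrier) (N : ℕ) where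

      open import Data.Nat.Base using (_≤_)
      open Tree α (quasiFrame S) (_∈ Ls) (_≤ N) public

      paths : ℕ → List Path
      paths ℕ.zero    = map root S
      paths (ℕ.suc n) = paths n ++
        cartesianProductWith (λ p (k , w) → p ▹[ k ] w) (paths n) (cartesianProduct Ls S)

      paths-complete : ∀ n p → Legal p → len p ≤ n → p ∈ paths n
      paths-complete ℕ.zero    (root w) (w∈ , _) _ = ∈-map⁺ root w∈
      paths-complete (ℕ.suc n) (root w) v        _ = ∈-++⁺ˡ (paths-complete n (root w) v z≤n)
      paths-complete (ℕ.suc n) (p ▹[ k ] w) (v , w∈ , _ , _ , k∈ , _) (s≤s p≤n) =
        ∈-++⁺ʳ (paths n) (∈-cartesianProductWith⁺ (λ p (k , w) → p ▹[ k ] w)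
          (paths-complete n p v p≤n) (∈-cartesianProduct⁺ k∈ w∈))

      len≤N : ∀ p → Legal p → len p ≤ N
      len≤N (root w)     (_ , 0≤N)                 = 0≤N
      len≤N (p ▹[ k ] w) (_ , _ , _ , _ , _ , p<N) = p<N

      module _ (nonempty : ∃ (_∈ S)) where

        private
          𝔅 : Alg α ℓ ℓ
          𝔅 = Cm tree

        truncation-finiteBase : FiniteBaseDrs α 𝔅
        truncation-finiteBase =
          tree-Drs (quasiFrame S) nonempty (_∈ Ls) (_≤ N) z≤n , paths N ,
          λ { (f , (p , lp , f≋) , j , refl) →
                subst (_∈ paths N) (sym (f≋ j)) (paths-complete N (coordinate p j)
                  (coordinate-valid p j lp) (len≤N _ (coordinate-valid p j lp))) }

        -- By `∼-unlabelled`, every index outside the finite list `Ls` acts as the identity.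
        truncation-locallyFinite : LocallyFinite α 𝔅
        truncation-locallyFinite X = Ls , λ {i} ¬closed → decidable-stable em↓ λ i∉ →
          ¬closed λ p lp → Bool.⇔→≡ (mk⇔
            (λ ◇X → let q , lq , p∼q , Xq = ◇⁻ tree {i} {X} {p} ◇X in
              subst (λ q → X q ≡ true) (sym (∼-unlabelled 2≤α i∉ lp lq p∼q)) Xq)
            (λ Xp → ⌊⌋⁺ (p , lp , (λ _ _ → refl) , Xp)))

      -- The bound is a budget: each cylindrification lowers `depth` by one and lengthens the path
      -- by at most one, so there is room for the next step.
      tree-truth : ∀ (v : ℕ → Point r → Bool) t → (∀ {i} → i ∈ indices t → i ∈ Ls) → ∀ p → Legal p →
                   len p ℕ.+ depth t ≤ N →
                   eval (Cm tree) (λ n → v n ∘ end) t p ≡ eval (Cm (quasiFrame S)) v t (end p)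
      tree-truth v (var n)  ⊆L p lp b = refl
      tree-truth v (t ·ᵗ u) ⊆L p lp b = cong₂ _∧_
        (tree-truth v t (⊆L ∘ ∈-++⁺ˡ) p lp (ℕ.≤-trans (ℕ.+-monoʳ-≤ (len p) (ℕ.m≤m⊔n _ _)) b))
        (tree-truth v u (⊆L ∘ ∈-++⁺ʳ (indices t)) p lp
          (ℕ.≤-trans (ℕ.+-monoʳ-≤ (len p) (ℕ.m≤n⊔m (depth t) _)) b))
      tree-truth v (t +ᵗ u) ⊆L p lp b = cong₂ _∨_
        (tree-truth v t (⊆L ∘ ∈-++⁺ˡ) p lp (ℕ.≤-trans (ℕ.+-monoʳ-≤ (len p) (ℕ.m≤m⊔n _ _)) b))
        (tree-truth v u (⊆L ∘ ∈-++⁺ʳ (indices t)) p lp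
          (ℕ.≤-trans (ℕ.+-monoʳ-≤ (len p) (ℕ.m≤n⊔m (depth t) _)) b))
      tree-truth v (-ᵗ t)   ⊆L p lp b = cong not (tree-truth v t ⊆L p lp b)
      tree-truth v 0ᵗ       ⊆L p lp b = refl
      tree-truth v 1ᵗ       ⊆L p lp b = refl
      tree-truth v (cᵗ i t) ⊆L p lp b = ⌊⌋-ext
        (λ (q , lq , p∼q , tq) → end q , end-domain q lq , ∼⇒end∼ 2≤α {p = p} {q} lp lq p∼q ,
          trans (sym (IH q lq p∼q)) tq)
        (λ (w , w∈ , p∼w , tw) →
          let q , lq , p∼q , q≡w = lift-∼ ℕ.≤-trans {p = p} lp (⊆L (here refl))
                (ℕ.≤-trans (s≤s (ℕ.m≤m+n (len p) (depth t))) b′) w∈ p∼w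
          in q , lq , p∼q , trans (IH q lq p∼q) (trans (cong (eval _ v t) q≡w) tw))
        where
        b′ : ℕ.suc (len p) ℕ.+ depth t ≤ N
        b′ = ℕ.≤-trans (ℕ.≤-reflexive (sym (ℕ.+-suc (len p) (depth t)))) b
        IH : ∀ q → Legal q → Frame._∼[_]_ tree p i q →
             eval (Cm tree) (λ n → v n ∘ end) t q ≡ eval (Cm (quasiFrame S)) v t (end q)
        IH q lq p∼q = tree-truth v t (⊆L ∘ there) q lq
          (ℕ.≤-trans (ℕ.+-monoˡ-≤ (depth t) (∼⇒len≤ 2≤α {p = p} {q} lp lq p∼q)) b′)

    refutable⇒⊭ : ∀ e → Refutable α e →
                  Σ[ 𝔅 ∈ Alg α ℓ ℓ ] FiniteBaseDrs α 𝔅 × LocallyFinite α 𝔅 × ¬ (𝔅 ⊨ e)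
    refutable⇒⊭ (t ≈ᵗ u) refutable
      with S , _ , (coherent , saturated) , refuted ← find refutable
      with p , p∈ , t≢u ← find refuted =
      Cm tree , truncation-finiteBase (p , p∈) , truncation-locallyFinite (p , p∈) , λ 𝔅⊨e →
        t≢u (trans (sym (truth t (proj₁ ∘ guess) (λ _ → proj₁) (λ _ _ → proj₁) (proj₁ saturated) ∈-++⁺ˡ (ℕ.m≤m⊔n _ _)))
          (trans (⊨⇒eval (Cm tree) t u 𝔅⊨e (λ n → quasiValuation n ∘ end) (root p) legal)
            (truth u (proj₂ ∘ guess) (λ _ → proj₂) (λ _ _ → proj₂) (proj₂ saturated) (∈-++⁺ʳ (indices t)) (ℕ.m≤n⊔m (depth t) _))))
      where
      r = t ·ᵗ u
      -- The equation is evaluated at a root, which has length 0, so `depth r` suffices as the cut.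
      open Truncation {r} S (indices r) (depth r)
      open import Data.Nat.Base using (_≤_)
      legal : Legal (root p)
      legal = p∈ , z≤n
      truth : ∀ s (π : Point r → Guess s) →
        (∀ i {p q} → Agree i r (guess p) (guess q) → Agree i s (π p) (π q)) →
        (∀ ρ p → Coherent ρ r (guess p) → Coherent ρ s (π p)) → Saturated S s π →
        (∀ {i} → i ∈ indices s → i ∈ indices r) → depth s ≤ depth r →
        eval (Cm tree) (λ n → quasiValuation n ∘ end) s (root p) ≡ valueAt s π p
      truth s π agr coh sat ⊆r d≤ = trans
        (tree-truth quasiValuation s ⊆r (root p) legal d≤)
        (quasi-truth s π agr (λ q∈ → coh _ _ (All.lookup coherent q∈)) sat p∈)

-- The five properties.

module Axiomatization {ℓ} (classical : Classical ℓ) (α : Ordinal ℓ) (2≤α : 2≤ α) where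

  open Classical classical
  open Complex excludedMiddle
  open Representability excludedMiddle α
  open Unravelling excludedMiddle α 2≤α

  Drs⇒axioms : ∀ {𝔄} → Drs α 𝔄 → Nondegenerate 𝔄 × SatisfiesAxioms 𝔄
  Drs⇒axioms 𝔄∈Drs =
    let F , nonempty , h = Drs⇒frame 𝔄∈Drs in
    embedding-reflects-nondegenerate h (Cm-nondegenerate F nonempty) ,
    satisfiesAxioms-reflect h (Cm-satisfiesAxioms excludedMiddle F)

  axioms⇒Drs : ∀ {𝔄} → Nondegenerate 𝔄 → SatisfiesAxioms 𝔄 → Drs α 𝔄
  axioms⇒Drs 0≉1 sat = frame⇒Drs {F = canonicalFrame} (canonical-nonempty 0≉1) canonical-embedding
    where open CanonicalFrame classical sat

  finiteSchemaAxiomatizable : FiniteSchemaAxiomatizable (Drs α)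
  finiteSchemaAxiomatizable = axiomSchemas ,
    (λ 𝔄∈Drs → let 0≉1 , sat = Drs⇒axioms 𝔄∈Drs in 0≉1 , axioms⇒schemas sat) ,
    (λ (0≉1 , sat) → axioms⇒Drs 0≉1 (schemas⇒axioms sat))

  finitelyAxiomatizable : FiniteOrdinal α → FinitelyAxiomatizable (Drs α)
  finitelyAxiomatizable (is , all-is) = axiomList is ,
    (λ 𝔄∈Drs → let 0≉1 , sat = Drs⇒axioms 𝔄∈Drs in 0≉1 , axioms⇒list is∋ sat) ,
    (λ (0≉1 , sat) → axioms⇒Drs 0≉1 (list⇒axioms is∋ sat))
    where
    is∋ : ∀ i → i ∈ is
    is∋ i = all-is _

  -- As `Drs` is already known to be a variety, it is enough that every equation failing in it fails
  -- in a member of `G`.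
  variety-generated : ∀ {s} (G : Pred (Alg α ℓ ℓ) s) → G ⊆ Drs α →
    (∀ {𝔄} e → Drs α 𝔄 → ¬ (𝔄 ⊨ e) → ∃ λ 𝔅 → G 𝔅 × ¬ (𝔅 ⊨ e)) →
    GeneratedAsVarietyBy (Drs α) G
  variety-generated G G⊆Drs refute =
    (InstanceOf axiomSchemas , proj₂ finiteSchemaAxiomatizable) , G⊆Drs ,
    λ Γ G⊆Γ 𝔄∈Drs → proj₁ (Drs⇒axioms 𝔄∈Drs) , λ {e} Γe →
      decidable-stable em↓ λ 𝔄⊭e →
        let 𝔅 , G𝔅 , 𝔅⊭e = refute e 𝔄∈Drs 𝔄⊭e in 𝔅⊭e (proj₂ (G⊆Γ G𝔅) Γe)

  open Correctness excludedMiddle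

  generatedByFiniteBase : GeneratedAsVarietyBy (Drs α) (FiniteBaseDrs α)
  generatedByFiniteBase = variety-generated (FiniteBaseDrs α) proj₁ λ e 𝔄∈Drs 𝔄⊭e →
    let 𝔅 , finite , _ , 𝔅⊭e = refutable⇒⊭ α 2≤α e (⊭⇒refutable α 2≤α 𝔄∈Drs e 𝔄⊭e)
    in 𝔅 , finite , 𝔅⊭e

  generatedByLocallyFinite : GeneratedAsVarietyBy (Drs α) (LocallyFiniteDrs α)
  generatedByLocallyFinite = variety-generated (LocallyFiniteDrs α) proj₁ λ e 𝔄∈Drs 𝔄⊭e →
    let 𝔅 , finite , locallyFinite , 𝔅⊭e = refutable⇒⊭ α 2≤α e (⊭⇒refutable α 2≤α 𝔄∈Drs e 𝔄⊭e)
    in 𝔅 , (proj₁ finite , locallyFinite) , 𝔅⊭e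

  valid⇔¬refutable : ∀ e → Reflects (Valid (Drs α) e) (not (does (refutable? α e)))
  valid⇔¬refutable e with refutable? α e
  ... | yes refutable = ofⁿ λ valid →
    let 𝔅 , finite , _ , 𝔅⊭e = refutable⇒⊭ α 2≤α e refutable in 𝔅⊭e (valid 𝔅 (proj₁ finite))
  ... | no ¬refutable = ofʸ λ 𝔄 𝔄∈Drs → decidable-stable em↓ λ 𝔄⊭e →
    ¬refutable (⊭⇒refutable α 2≤α 𝔄∈Drs e 𝔄⊭e)

  superAmalgamation : SuperAmalgamation (Drs α)
  superAmalgamation 𝔄₀ 𝔄₁ 𝔄₂ 𝔄₀∈ 𝔄₁∈ 𝔄₂∈ e₁ e₂ =
    -- The full complex algebra serves as the amalgam, so the embedding to be unravelled is the
    -- identity.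
    Cm pairs , frame⇒Drs {F = pairs} (pairs-nonempty (proj₁ (Drs⇒axioms 𝔄₁∈))) idᵉ ,
    m₁ , m₂ , (λ z w (_ , _ , u≡v) → u≡v z) ,
    (λ x y x≤y → interpolant x y λ {w} d → below {proj₁ w x} (x≤y w d)) ,
    (λ y x y≤x → Swapped.interpolant y x λ {w} (vU , uU , v≡u) →
      below {proj₁ w y} (y≤x (swap w) (uU , vU , λ z → sym (v≡u z))))
    where
    sat₀ = proj₂ (Drs⇒axioms 𝔄₀∈)
    sat₁ = proj₂ (Drs⇒axioms 𝔄₁∈)
    sat₂ = proj₂ (Drs⇒axioms 𝔄₂∈)
    open Amalgam classical sat₀ sat₁ sat₂ e₁ e₂
    module Swapped = Amalgam classical sat₀ sat₂ sat₁ e₂ e₁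
    m₁ : Embedding 𝔄₁ (Cm pairs)
    m₁ = CanonicalFrame.Covering.covering-embedding covering₁
    m₂ : Embedding 𝔄₂ (Cm pairs)
    m₂ = CanonicalFrame.Covering.covering-embedding (covering₂ classical sat₀ sat₁ sat₂ e₁ e₂)
    below : ∀ {x y} → x ∧ y ≡ x → x ≡ true → y ≡ true
    below x∧y≡x refl = x∧y≡x

theorem1 : ∀ {ℓ : Level} (α : Ordinal ℓ) → 2≤ α →
    (Classical ℓ →
    FiniteSchemaAxiomatizable (Drs α) ×
    (FiniteOrdinal α → FinitelyAxiomatizable (Drs α))) ×
    (Classical ℓ → GeneratedAsVarietyBy (Drs α) (FiniteBaseDrs α)) ×
    DecidableEquationalTheory ℓ (Drs α) ×
    (Classical ℓ → ¬ FiniteOrdinal α →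
    GeneratedAsVarietyBy (Drs α) (LocallyFiniteDrs α)) ×
    (Classical ℓ → SuperAmalgamation (Drs α))
theorem1 α 2≤α =
  (λ classical → let open Axiomatization classical α 2≤α in
    finiteSchemaAxiomatizable , finitelyAxiomatizable) ,
  (λ classical → Axiomatization.generatedByFiniteBase classical α 2≤α) ,
  -- The deciding function is the constructive search itself; classical principles enter only its
  -- correctness proof.
  ((λ e → not (does (refutable? α e))) ,
   λ classical → Axiomatization.valid⇔¬refutable classical α 2≤α) ,
  (λ classical _ → Axiomatization.generatedByLocallyFinite classical α 2≤α) ,
  (λ classical → Axiomatization.superAmalgamation classical α 2≤α)
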